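{- Let \[S(c,t)=\sum_{r,s\ge0}N_{r,s}\,c^rt^s\in\mathbb{Q}[[c,t]],\] where $N_{r,s}$ is the number of distinct elements of $M$ that are skeleta of some finite $(3+1)$-free poset and contain exactly $r$ letters of the form $c_i$ (clone sets) and $s$ letters of the form $t_{i\,i+1}$ (tangles). Then $S(c,t)$ satisfies \[S(c,t)=1+\frac{c}{1+c}S(c,t)^2+tS(c,t)^3,\] and it is the unique formal power series in $\mathbb{Q}[[c,t]]$ satisfying this equation.
   Context: A poset $P$ is $(3+1)$-free if there are no $a,b,c,d\in P$ with $a<b<c$ and $d$ incomparable to each of $a,b,c$. For $a\in P$ let $D_a=\{x\in P:x<a\}$, $U_a=\{x\in P:x>a\}$. Write $a\mathrel{\top}b$ if neither of $D_a,D_b$ contains the other, $a\mathrel{\bot}b$ if neither of $U_a,U_b$ contains the other, and $a\approx b$ if $D_a=D_b$ and $U_a=U_b$. A top of a tangle is a subset $A\subseteq P$ with $|A|\ge2$ that is a connected component of the graph on $P$ with edges $\{a,b\}$ for $a\mathrel{\top}b$; a bottom of a tangle is defined likewise using $\bot$. A top $A$ and bottom $B$ are matched if there are distinct $a_1,a_2\in A$, $b_1,b_2\in B$ with $b_1<a_1$, $b_2<a_2$ and the pairs $\{a_1,a_2\},\{b_1,b_2\},\{b_1,a_2\},\{b_2,a_1\}$ incomparable; in a $(3+1)$-free poset this is a perfect matching. A tangle is a matched pair $(A,B)$, identified with $A\cup B$; a clone set is an equivalence class of $\approx$ on the vertices in no tangle; clone sets and tangles are the parts of $P$. Levels: $L_1$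 = minimal elements of $P$, $L_{k+1}$ = minimal elements of $P\setminus(L_1\cup\dots\cup L_k)$, $\ell(a)=k$ if $a\in L_k$; each clone set lies in one level, each tangle in $L_i\cup L_{i+1}$ for some $i$. A compatible listing is an ordering $(X_1,\dots,X_m)$ of all parts such that for $a\in X_i$, $b\in X_j$, $i\ne j$: $a<b$ iff $\ell(a)\le\ell(b)-2$, or $\ell(a)=\ell(b)-1$ and $i<j$ (compatible listings exist). Let $\Sigma=\{c_1,c_2,\dots\}\cup\{t_{12},t_{23},\dots\}$, $\Sigma^*$ the free monoid on $\Sigma$, and $M$ the quotient of $\Sigma^*$ by the commutation relations $c_ic_j=c_jc_i$ if $|i-j|\ge2$; $c_it_{j\,j+1}=t_{j\,j+1}c_i$ if $i\le j-2$ or $i\ge j+3$; $t_{i\,i+1}t_{j\,j+1}=t_{j\,j+1}t_{i\,i+1}$ if $|i-j|\ge3$. The word of a compatible listing replaces each clone set at level $i$ by $c_i$ and each tangle in levels $\{i,i+1\}$ by $t_{i\,i+1}$; all compatible listings of $P$ give words with the same image in $M$, called the skeleton of $P$ (the empty poset has the empty skeleton). -}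

module Defs where

open import Data.Fin using (Fin; zero; suc; toℕ) renaming (_<_ to _<ᶠ_)
open import Data.Fin.Properties using (injective⇒≤)
open import Data.Fin.Subset using (Subset; _∈_; _∉_; _∪_; ∣_∣)
open import Data.Integer using (+_)
open import Data.List using (List; []; _∷_; length; lookup)
open import Data.List.Membership.Propositional renaming (_∈_ to _∈ˡ_) using ()
open import Data.List.Relation.Binary.Pointwise using (Pointwise)
open import Data.List.Relation.Unary.Unique.Propositional using (Unique)
open import Data.Nat as ℕ using (ℕ; zero; suc; _≤_; _∸_; ∣_-_∣)
open import Data.Nat.Properties using (≤-antisym)
open import Data.Product using (Σ; ∃; ∃-syntax; _×_; proj₁; proj₂)
open import Data.Rational using (ℚ; 0ℚ; 1ℚ; _/_; -_) renaming (_+_ to _+ℚ_; _*_ to _*ℚ_)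
open import Data.Rational.Properties using (+-0-commutativeMonoid; *-identityˡ; *-zeroˡ; +-identityʳ; +-inverseˡ)
open import Data.Sum using (_⊎_)
open import Function using (_∘_; _⇔_; Bijection)
open import Level using (0ℓ; _⊔_) renaming (suc to lsuc)
open import Relation.Binary using (Rel; Setoid; IsDecStrictPartialOrder)
open import Relation.Binary.Construct.Closure.ReflexiveTransitive using (Star)
open import Relation.Binary.PropositionalEquality using (_≡_; _≢_; refl; cong; cong₂; trans)
open import Relation.Nullary using (¬_)
open import Relation.Unary using (Pred; U; ∁; _∩_; _⊆_; _≐_)
import Relation.Binary.Construct.Closure.Equivalence as EqC
import Relation.Binary.Construct.On as On
import Relation.Binary.PropositionalEquality as ≡
open import Algebra.Properties.CommutativeMonoid.Sum +-0-commutativeMonoid using (sum⁺-syntax; sum; sum-cong-≗; sum-replicate-zero)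

infix 4 _↝_ _≈ₛ_
infixl 6 _+ₛ_
infixl 7 _*ₛ_

------------------------------------------------------------------------
-- The monoid M.  All level indices start at 0: c i is the letter
-- c_{i+1} and t i is the letter t_{i+1 i+2}, so every index is legal.

data Letter : Set where
  c t : ℕ → Letter

Word : Set
Word = List Letter

data Commutes : Rel Letter 0ℓ where
  c-c : ∀ {i j} → 2 ≤ ∣ i - j ∣ → Commutes (c i) (c j)
  c-t : ∀ {i j} → i ℕ.+ 2 ≤ j ⊎ j ℕ.+ 3 ≤ i → Commutes (c i) (t j)
  t-t : ∀ {i j} → 3 ≤ ∣ i - j ∣ → Commutes (t i) (t j)

data _↝_ : Rel Word 0ℓ where
  swap : ∀ {x y} w → Commutes x y → x ∷ y ∷ w ↝ y ∷ x ∷ w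
  skip : ∀ {u v} x → u ↝ v → x ∷ u ↝ x ∷ v

-- Elements of M are words up to the congruence generated by Commutes.
M : Setoid 0ℓ 0ℓ
M = EqC.setoid _↝_

open Setoid M public using () renaming (_≈_ to _≈ᴹ_)

#c #t : Word → ℕ
#c []        = 0
#c (c _ ∷ w) = suc (#c w)
#c (t _ ∷ w) = #c w
#t []        = 0
#t (c _ ∷ w) = #t w
#t (t _ ∷ w) = suc (#t w)

------------------------------------------------------------------------
-- Finite posets, given by a strict order on Fin n.

-- A tangle is kept as its pair (top , bottom).
data Part (n : ℕ) : Set where
  cloneSet : Subset n → Part n
  tangle   : Subset n → Subset n → Part n

elements : ∀ {n} → Part n → Subset n
elements (cloneSet C) = C
elements (tangle A B) = A ∪ B

module FinitePoset {n : ℕ} (_<_ : Rel (Fin n) 0ℓ) where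

  Incomparable : Rel (Fin n) 0ℓ
  Incomparable a b = a ≢ b × ¬ a < b × ¬ b < a

  ⟨3+1⟩-Free : Set
  ⟨3+1⟩-Free = ¬ (∃[ x ] ∃[ y ] ∃[ z ] ∃[ w ] x < y × y < z ×
    Incomparable w x × Incomparable w y × Incomparable w z)

  D↓ U↑ : Fin n → Pred (Fin n) 0ℓ
  D↓ a x = x < a
  U↑ a x = a < x

  _⊤_ _⊥_ _≈_ : Rel (Fin n) 0ℓ
  a ⊤ b = ¬ D↓ a ⊆ D↓ b × ¬ D↓ b ⊆ D↓ a
  a ⊥ b = ¬ U↑ a ⊆ U↑ b × ¬ U↑ b ⊆ U↑ a
  a ≈ b = D↓ a ≐ D↓ b × U↑ a ≐ U↑ b

  -- Used for symmetric R only, so Star R is connectedness by a path.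
  IsComponent : Rel (Fin n) 0ℓ → Subset n → Set
  IsComponent R A = ∃[ a ] (∀ x → x ∈ A ⇔ Star R a x)

  IsTop IsBottom : Subset n → Set
  IsTop    A = 2 ≤ ∣ A ∣ × IsComponent _⊤_ A
  IsBottom B = 2 ≤ ∣ B ∣ × IsComponent _⊥_ B

  Matched : Subset n → Subset n → Set
  Matched A B = ∃[ a₁ ] ∃[ a₂ ] ∃[ b₁ ] ∃[ b₂ ]
    a₁ ∈ A × a₂ ∈ A × a₁ ≢ a₂ × b₁ ∈ B × b₂ ∈ B × b₁ ≢ b₂ ×
    b₁ < a₁ × b₂ < a₂ ×
    Incomparable a₁ a₂ × Incomparable b₁ b₂ ×
    Incomparable b₁ a₂ × Incomparable b₂ a₁

  IsTangle : Subset n → Subset n → Set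
  IsTangle A B = IsTop A × IsBottom B × Matched A B

  InNoTangle : Pred (Fin n) 0ℓ
  InNoTangle x = ∀ A B → IsTangle A B → x ∉ A ∪ B

  IsCloneSet : Subset n → Set
  IsCloneSet C = ∃[ a ] InNoTangle a × (∀ x → x ∈ C ⇔ (InNoTangle x × a ≈ x))

  IsPart : Part n → Set
  IsPart (cloneSet C) = IsCloneSet C
  IsPart (tangle A B) = IsTangle A B

  Minimal : Pred (Fin n) 0ℓ → Pred (Fin n) 0ℓ
  Minimal Q x = Q x × (∀ y → Q y → ¬ y < x)

  -- Remaining k = P ∖ (L₁ ∪ … ∪ L_k), and Level k = L_{k+1}.
  Remaining Level : ℕ → Pred (Fin n) 0ℓ
  Remaining zero    = U
  Remaining (suc k) = Remaining k ∩ ∁ (Level k)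
  Level k = Minimal (Remaining k)

  record IsCompatibleListing (Xs : List (Part n)) : Set where
    field
      unique     : Unique Xs
      parts      : ∀ X → X ∈ˡ Xs ⇔ IsPart X
      compatible : ∀ (i j : Fin (length Xs)) → i ≢ j →
                   ∀ a b → a ∈ elements (lookup Xs i) → b ∈ elements (lookup Xs j) →
                   ∀ k l → Level k a → Level l b →
                   a < b ⇔ (k ℕ.+ 2 ≤ l ⊎ (k ℕ.+ 1 ≡ l × i <ᶠ j))

  data HasLetter : Part n → Letter → Set where
    clone-c  : ∀ {C i} → (∀ x → x ∈ C → Level i x) → HasLetter (cloneSet C) (c i)
    tangle-t : ∀ {A B i} → (∀ x → x ∈ A ∪ B → Level i x ⊎ Level (suc i) x) →
               HasLetter (tangle A B) (t i)

  -- w represents the class in M of the word of a compatible listing.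
  HasSkeleton : Word → Set
  HasSkeleton w = ∃[ Xs ] IsCompatibleListing Xs ×
    (∃[ v ] Pointwise HasLetter Xs v × v ≈ᴹ w)

open FinitePoset using (⟨3+1⟩-Free; HasSkeleton)

IsSkeleton : Word → Set₁
IsSkeleton w = ∃[ n ] Σ (Rel (Fin n) 0ℓ) λ _<_ →
  IsDecStrictPartialOrder _≡_ _<_ × ⟨3+1⟩-Free _<_ × HasSkeleton _<_ w

-- The subset of M consisting of skeleta with r clone sets and s tangles.
Skeleta : ℕ → ℕ → Setoid (lsuc 0ℓ) 0ℓ
Skeleta r s = On.setoid {B = ∃[ w ] IsSkeleton w × #c w ≡ r × #t w ≡ s} M proj₁

HasCardinality : ∀ {a ℓ} → Setoid a ℓ → ℕ → Set (a ⊔ ℓ)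
HasCardinality A k = Bijection (≡.setoid (Fin k)) A

HasCardinality-unique : ∀ {a ℓ} (A : Setoid a ℓ) {k m} →
                        HasCardinality A k → HasCardinality A m → k ≡ m
HasCardinality-unique A f g = ≤-antisym (bound f g) (bound g f)
  where
  open Setoid A using () renaming (trans to ≈-trans; sym to ≈-sym; reflexive to ≈-reflexive)
  bound : ∀ {k m} → HasCardinality A k → HasCardinality A m → k ≤ m
  bound {k} {m} f g = injective⇒≤ {f = h} inj
    where
    module F = Bijection f
    module G = Bijection g
    h : Fin k → Fin m
    h i = proj₁ (G.strictlySurjective (F.to i))
    h-spec : ∀ i → Setoid._≈_ A (G.to (h i)) (F.to i)
    h-spec i = proj₂ (G.strictlySurjective (F.to i))
    inj : ∀ {i j} → h i ≡ h j → i ≡ j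
    inj {i} {j} hi≡hj = F.injective
      (≈-trans (≈-sym (h-spec i)) (≈-trans (≈-reflexive (cong G.to hi≡hj)) (h-spec j)))

------------------------------------------------------------------------
-- The ring ℚ[[c,t]]: F r s is the coefficient of c^r t^s in F.

Series : Set
Series = ℕ → ℕ → ℚ

_≈ₛ_ : Rel Series 0ℓ
F ≈ₛ G = ∀ r s → F r s ≡ G r s

_+ₛ_ _*ₛ_ : Series → Series → Series
(F +ₛ G) r s = F r s +ℚ G r s
(F *ₛ G) r s = ∑[ i ≤ r ] ∑[ j ≤ s ] (F (toℕ i) (toℕ j) *ℚ G (r ∸ toℕ i) (s ∸ toℕ j))

1ₛ cₛ tₛ : Series
1ₛ 0 0 = 1ℚ
1ₛ _ _ = 0ℚ
cₛ 1 0 = 1ℚ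
cₛ _ _ = 0ℚ
tₛ 0 1 = 1ℚ
tₛ _ _ = 0ℚ

-- 1 - c + c² - c³ + …, shown below to be the inverse of 1 + c.
1/[1+c] : Series
1/[1+c] zero    zero    = 1ℚ
1/[1+c] (suc r) zero    = - 1/[1+c] r zero
1/[1+c] _       (suc _) = 0ℚ

private
  sum-zero : ∀ n (f : Fin n → ℚ) → (∀ i → f i ≡ 0ℚ) → sum f ≡ 0ℚ
  sum-zero n f f≡0 = trans (sum-cong-≗ f≡0) (sum-replicate-zero n)

  row : ∀ {n} (f : Fin (suc n) → ℚ) → (∀ j → f (suc j) ≡ 0ℚ) → sum f ≡ f zero
  row f f≡0 = trans (cong (f zero +ℚ_) (sum-zero _ (f ∘ suc) f≡0)) (+-identityʳ _)

  G : Series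
  G = 1/[1+c]

  cancel : ∀ r s → G (suc r) s +ℚ G r s ≡ 0ℚ
  cancel r zero    = +-inverseˡ (G r zero)
  cancel r (suc s) = cong₂ _+ℚ_ (vanish (suc r)) (vanish r)
    where
    vanish : ∀ r → G r (suc s) ≡ 0ℚ
    vanish zero    = refl
    vanish (suc _) = refl

  term : ℕ → ℕ → ℕ → ℕ → ℚ
  term r s i j = (1ₛ +ₛ cₛ) i j *ℚ G (r ∸ i) (s ∸ j)

1/[1+c]-inverse : (1ₛ +ₛ cₛ) *ₛ 1/[1+c] ≈ₛ 1ₛ
1/[1+c]-inverse zero s =
  trans (+-identityʳ (∑[ j ≤ s ] term 0 s 0 (toℕ j)))
    (trans (row {s} (term 0 s 0 ∘ toℕ) λ j → *-zeroˡ (G 0 (s ∸ suc (toℕ j))))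
      (trans (*-identityˡ (G 0 s)) (eq s)))
  where
  eq : ∀ s → G 0 s ≡ 1ₛ 0 s
  eq zero    = refl
  eq (suc _) = refl
1/[1+c]-inverse (suc r) s =
  trans (cong₂ _+ℚ_
    (trans (row {s} (term (suc r) s 0 ∘ toℕ) λ j → *-zeroˡ (G (suc r) (s ∸ suc (toℕ j))))
           (*-identityˡ (G (suc r) s)))
    (trans (row {r} (λ i → ∑[ j ≤ s ] term (suc r) s (suc (toℕ i)) (toℕ j)) λ i →
              sum-zero (suc s) (term (suc r) s (suc (suc (toℕ i))) ∘ toℕ) λ j →
                *-zeroˡ (G (r ∸ suc (toℕ i)) (s ∸ toℕ j)))
      (trans (row {s} (term (suc r) s 1 ∘ toℕ) λ j → *-zeroˡ (G r (s ∸ suc (toℕ j))))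
             (*-identityˡ (G r s)))))
    (cancel r s)

genFun : (ℕ → ℕ → ℕ) → Series
genFun N r s = + N r s / 1

SatisfiesEquation : Series → Set
SatisfiesEquation F =
  F ≈ₛ 1ₛ +ₛ cₛ *ₛ 1/[1+c] *ₛ (F *ₛ F) +ₛ tₛ *ₛ (F *ₛ F *ₛ F)

{-# OPTIONS --safe #-}
-- Write [start x , end x] for the levels met by a letter x.  Two letters commute
-- iff one interval lies at least two levels below the other (x ≪ y), and ≪ is
-- transitive.  Hence every element of M has exactly one representative without
-- adjacent letters x ≪ y.  Such a normal word is a skeleton iff its first letter
-- starts at level 0 and it has no adjacent c i, c i: adjacent letters x, y then
-- satisfy start y ≤ end x + 1, so every level is reached from the one below, and
-- two clone sets c i are always separated by a letter meeting level i ± 1.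
--
-- Let P k count the words of this kind whose first letter starts below level k.
-- Classifying by the first letter gives P (k+1) = P k + X k + t P (k+3) and
-- X k = c (P (k+2) − X k).  These recurrences determine P and X, and the powers
-- P k = T^k, X k = c/(1+c) T^(k+2) of the solution T of the equation satisfy them.
module Submission where

open import Defs
open import Algebra.Bundles using (CommutativeRing)
open import Data.Empty using (⊥-elim)
open import Data.Fin using (Fin; zero; suc; toℕ; combine; remQuot) renaming (_<_ to _<ᶠ_)
open import Data.Fin.Patterns using (0F; 1F)
open import Data.Fin.Properties using (all?; toℕ≤pred[n])
open import Data.Fin.Subset using (Subset; _∈_; _∉_; _∪_; ∣_∣)
open import Data.Fin.Subset.Properties using (_∈?_; ⊆-antisym; x∈p∪q⁺; x∈p∪q⁻; x∈p⇒∣p-x∣<∣p∣; x∈p∧x≢y⇒x∈p-y)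
open import Data.Integer as ℤ using (+_)
open import Data.List using (List; []; _∷_; _++_; length; map; lookup; head)
open import Data.List.Membership.Propositional using (find; lose) renaming (_∈_ to _∈ˡ_)
open import Data.List.Membership.Propositional.Properties using (∈-map⁺; ∈-map⁻; ∈-++⁺ˡ; ∈-++⁺ʳ; ∈-++⁻; ∈-lookup; ∈-tabulate⁺; ∈-tabulate⁻)
open import Data.List.Properties using (length-++; length-map; ∷-injectiveʳ; tabulate-lookup)
open import Data.List.Relation.Binary.Disjoint.Propositional using (Disjoint)
open import Data.List.Relation.Binary.Permutation.Propositional using (_↭_; ↭-refl; ↭-trans; ↭-sym; prep; swap)
open import Data.List.Relation.Binary.Permutation.Propositional.Properties using (All-resp-↭; ∈-resp-↭)
open import Data.List.Relation.Binary.Pointwise using (Pointwise; []; _∷_)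
open import Data.List.Relation.Unary.All using (All; []; _∷_)
open import Data.List.Relation.Unary.AllPairs using (AllPairs; []; _∷_)
open import Data.List.Relation.Unary.Any using (Any; here; there; any?; index)
open import Data.List.Relation.Unary.Any.Properties using (lookup-index)
open import Data.List.Relation.Unary.Linked using (Linked; []; [-]; _∷_)
open import Data.List.Relation.Unary.Unique.Propositional using (Unique)
open import Data.Maybe using (just)
open import Data.Nat as ℕ using (ℕ; zero; suc; _∸_; _≤_; z≤n; s≤s; ∣_-_∣)
open import Data.Product using (Σ; _×_; _,_; ∃-syntax; proj₁; proj₂)
open import Data.Rational using (ℚ; 0ℚ; _/_) renaming (_+_ to _+ℚ_; _*_ to _*ℚ_)
open import Data.Rational.Unnormalised as ℚᵘ using (mkℚᵘ; *≡*) renaming (_≃_ to _≃ᵘ_)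
open import Data.Sum using (_⊎_; inj₁; inj₂; [_,_]′)
open import Data.Vec using (tabulate)
open import Data.Vec.Properties using (lookup∘tabulate; lookup⇒[]=; []=⇒lookup)
open import Function using (_∘_; id; _⇔_; mk⇔; Equivalence)
open import Level using (0ℓ)
open import Relation.Binary using (Rel; IsDecStrictPartialOrder; Decidable; tri<; tri≈; tri>)
open import Relation.Binary.Construct.Closure.ReflexiveTransitive using (Star; ε; _◅_; _◅◅_)
open import Relation.Binary.Construct.Closure.Symmetric using (fwd; bwd)
open import Relation.Binary.PropositionalEquality as ≡ using (_≡_; _≢_)
open import Relation.Nullary using (¬_; yes; no; contradiction; Dec; does)
open import Relation.Nullary.Decidable using (map′; _×-dec_; _⊎-dec_; _→-dec_; ¬?; dec-true)
open import Relation.Unary using (Pred; _⊆_)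
import Algebra.Properties.CommutativeMonoid.Sum as Sum
import Algebra.Properties.CommutativeSemigroup as CommSemigroup
import Algebra.Properties.Group as GroupProperties
import Data.Empty as Empty
import Data.Fin.Properties as Finₚ
import Data.Integer.Properties as ℤₚ
import Data.List as List
import Data.List.Relation.Binary.Pointwise as Pointwise
import Data.List.Relation.Unary.All as All
import Data.List.Relation.Unary.AllPairs as AllPairs
import Data.List.Relation.Unary.AllPairs.Properties as AllPairsₚ
import Data.List.Relation.Unary.Unique.Propositional.Properties as Unique
import Data.Nat.Properties as ℕₚ
import Data.Nat.Tactic.RingSolver as ℕ-Solver
import Data.Rational.Properties as ℚₚ
import Data.Rational.Unnormalised.Properties as ℚᵘₚ
import Relation.Binary.Construct.Closure.Equivalence as EqC
import Relation.Binary.Reasoning.Setoid as SetoidReasoning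

open Equivalence using (to; from)

-- Power series

-- Why a skeleton never has adjacent letters `c i`, `c i` in normal form: in a compatible listing
-- every other part comes before both neighbours or after both, so two neighbouring clone sets on
-- one level compare alike with every element and are the same `≈`-class. Sorting a listing along
-- with its word is harmless, since parts two levels apart are compatible in either order.
-- Conversely, compatibility dictates the order between the letters of a word. A tangle letter gets
-- two edges, the least that make a tangle; clone sets get four vertices to keep the encoding
-- uniform. It remains to see that the prescribed heights are the levels and that the parts of this
-- order are exactly the letters. Multiplying the equation by T^k gives linear relations between
-- powers of T, of the same shape as the removal of a first letter. The start is `P 0`, which counts
-- only the empty word, and the skeleta are counted by `P 1`. The fraction c/(1+c) encodes the ban
-- on repetition: after `c k` comes anything starting below level k+2, except `c k` itself.

module PowerSeries {a ℓ} (R : CommutativeRing a ℓ) where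
  open CommutativeRing R
  open Sum +-commutativeMonoid using (sum⁺-syntax)
  open CommSemigroup +-commutativeSemigroup using (interchange; x∙yz≈y∙xz)
  open SetoidReasoning setoid

  -- Unfolding the Cauchy product along its first factor makes all the
  -- ring laws provable by induction on the degree.
  conv : (ℕ → Carrier) → (ℕ → Carrier) → ℕ → Carrier
  conv f g zero    = f 0 * g 0
  conv f g (suc n) = f 0 * g (suc n) + conv (f ∘ suc) g n

  conv-sum : ∀ f g n → (∑[ i ≤ n ] (f (toℕ i) * g (n ∸ toℕ i))) ≈ conv f g n
  conv-sum f g zero    = +-identityʳ _
  conv-sum f g (suc n) = +-congˡ (conv-sum (f ∘ suc) g n)

  conv-cong : ∀ {f f′ g g′} → (∀ n → f n ≈ f′ n) → (∀ n → g n ≈ g′ n) → ∀ n → conv f g n ≈ conv f′ g′ n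
  conv-cong p q zero    = *-cong (p 0) (q 0)
  conv-cong p q (suc n) = +-cong (*-cong (p 0) (q (suc n))) (conv-cong (p ∘ suc) q n)

  -- The mirror unfolding, along the second factor; commutativity is the comparison of the two.
  conv-last : ∀ f g n → conv f g (suc n) ≈ f (suc n) * g 0 + conv f (g ∘ suc) n
  conv-last f g zero    = +-comm _ _
  conv-last f g (suc n) = trans (+-congˡ (conv-last (f ∘ suc) g n)) (x∙yz≈y∙xz _ _ _)

  conv-comm : ∀ f g n → conv f g n ≈ conv g f n
  conv-comm f g zero    = *-comm _ _
  conv-comm f g (suc n) = trans (+-cong (*-comm _ _) (conv-comm (f ∘ suc) g n)) (sym (conv-last g f n))

  conv-distribʳ : ∀ f g h n → conv (λ m → g m + h m) f n ≈ conv g f n + conv h f n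
  conv-distribʳ f g h zero    = distribʳ _ _ _
  conv-distribʳ f g h (suc n) =
    trans (+-cong (distribʳ _ _ _) (conv-distribʳ f (g ∘ suc) (h ∘ suc) n)) (interchange _ _ _ _)

  conv-distribˡ : ∀ f g h n → conv f (λ m → g m + h m) n ≈ conv f g n + conv f h n
  conv-distribˡ f g h n =
    trans (conv-comm f _ n) (trans (conv-distribʳ f g h n) (+-cong (conv-comm g f n) (conv-comm h f n)))

  conv-scale : ∀ x f g n → conv (λ m → x * f m) g n ≈ x * conv f g n
  conv-scale x f g zero    = *-assoc _ _ _
  conv-scale x f g (suc n) =
    trans (+-cong (*-assoc _ _ _) (conv-scale x (f ∘ suc) g n)) (sym (distribˡ _ _ _))

  conv-assoc : ∀ f g h n → conv (conv f g) h n ≈ conv f (conv g h) n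
  conv-assoc f g h zero    = *-assoc _ _ _
  conv-assoc f g h (suc n) = begin
    (f 0 * g 0) * h (suc n) + conv (λ m → f 0 * g (suc m) + conv (f ∘ suc) g m) h n
      ≈⟨ +-cong (*-assoc _ _ _) (conv-distribʳ h _ _ n) ⟩
    f 0 * (g 0 * h (suc n)) + (conv (λ m → f 0 * g (suc m)) h n + conv (conv (f ∘ suc) g) h n)
      ≈⟨ +-congˡ (+-cong (conv-scale _ _ _ n) (conv-assoc (f ∘ suc) g h n)) ⟩
    f 0 * (g 0 * h (suc n)) + (f 0 * conv (g ∘ suc) h n + conv (f ∘ suc) (conv g h) n)
      ≈⟨ +-assoc _ _ _ ⟨
    f 0 * (g 0 * h (suc n)) + f 0 * conv (g ∘ suc) h n + conv (f ∘ suc) (conv g h) n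
      ≈⟨ +-congʳ (distribˡ _ _ _) ⟨
    f 0 * conv g h (suc n) + conv (f ∘ suc) (conv g h) n ∎

  one : ℕ → Carrier
  one zero    = 1#
  one (suc _) = 0#

  conv-zeroˡ : ∀ f n → conv (λ _ → 0#) f n ≈ 0#
  conv-zeroˡ f zero    = zeroˡ _
  conv-zeroˡ f (suc n) = trans (+-cong (zeroˡ _) (conv-zeroˡ f n)) (+-identityˡ _)

  conv-identityˡ : ∀ f n → conv one f n ≈ f n
  conv-identityˡ f zero    = *-identityˡ _
  conv-identityˡ f (suc n) = trans (+-cong (*-identityˡ _) (conv-zeroˡ f n)) (+-identityʳ _)

  conv-identityʳ : ∀ f n → conv f one n ≈ f n
  conv-identityʳ f n = trans (conv-comm f one n) (conv-identityˡ f n)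

  powerSeriesRing : CommutativeRing a ℓ
  powerSeriesRing = record
    { Carrier = ℕ → Carrier
    ; _≈_ = λ f g → ∀ n → f n ≈ g n
    ; _+_ = λ f g n → f n + g n
    ; _*_ = conv
    ; -_ = λ f n → - f n
    ; 0# = λ _ → 0#
    ; 1# = one
    ; isCommutativeRing = record
      { isRing = record
        { +-isAbelianGroup = record
          { isGroup = record
            { isMonoid = record
              { isSemigroup = record
                { isMagma = record
                  { isEquivalence = record
                    { refl = λ _ → refl
                    ; sym = λ p n → sym (p n)
                    ; trans = λ p q n → trans (p n) (q n)
                    }
                  ; ∙-cong = λ p q n → +-cong (p n) (q n)
                  }
                ; assoc = λ _ _ _ _ → +-assoc _ _ _
                }
              ; identity = (λ _ _ → +-identityˡ _) , (λ _ _ → +-identityʳ _)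
              }
            ; inverse = (λ _ _ → -‿inverseˡ _) , (λ _ _ → -‿inverseʳ _)
            ; ⁻¹-cong = λ p n → -‿cong (p n)
            }
          ; comm = λ _ _ _ → +-comm _ _
          }
        ; *-cong = conv-cong
        ; *-assoc = conv-assoc
        ; *-identity = conv-identityˡ , conv-identityʳ
        ; distrib = conv-distribˡ , conv-distribʳ
        }
      ; *-comm = conv-comm
      }
    }

-- The functional equation in ℚ[[c,t]]

module SeriesEquation where
  module ℚ[[t]] = PowerSeries ℚₚ.+-*-commutativeRing
  -- The carrier is `Series` on the nose: the outer index is the exponent of c, the inner one that
  -- of t, and `_+ₛ_` is the ring addition by definition.
  module ℚ[[c,t]] = PowerSeries ℚ[[t]].powerSeriesRing
  open CommutativeRing ℚ[[c,t]].powerSeriesRing public using (_*_; _≈_; trans; sym)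
  open CommutativeRing ℚ[[c,t]].powerSeriesRing hiding (_-_; zero; _*_; _≈_; trans; sym)
  open Sum ℚₚ.+-0-commutativeMonoid using (sum⁺-syntax; sum; sum-cong-≗)

  *ₛ≈* : ∀ F G → F *ₛ G ≈ F * G
  *ₛ≈* F G r s = ≡.trans (sum-cong-≗ {suc r} λ i → ℚ[[t]].conv-sum (F (toℕ i)) (G (r ∸ toℕ i)) s) (go r F)
    where
    go : ∀ r F → (∑[ i ≤ r ] ℚ[[t]].conv (F (toℕ i)) (G (r ∸ toℕ i)) s) ≡ (F * G) r s
    go zero    F = ℚₚ.+-identityʳ _
    go (suc r) F = ≡.cong (ℚ[[t]].conv (F 0) (G (suc r)) s +ℚ_) (go r (F ∘ suc))

  1ₛ≈1 : 1ₛ ≈ 1#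
  1ₛ≈1 zero    zero    = ≡.refl
  1ₛ≈1 zero    (suc s) = ≡.refl
  1ₛ≈1 (suc r) s       = ≡.refl

  c*-zero : ∀ F s → (cₛ * F) 0 s ≡ 0ℚ
  c*-zero F s = ≡.trans (ℚ[[t]].conv-cong {g = F 0} {g′ = F 0} (λ _ → ≡.refl) (λ _ → ≡.refl) s) (ℚ[[t]].conv-zeroˡ (F 0) s)

  c*-suc : ∀ F r s → (cₛ * F) (suc r) s ≡ F r s
  c*-suc F r s = ≡.trans
    (≡.cong₂ _+ℚ_ (ℚ[[t]].conv-zeroˡ (F (suc r)) s) (trans (*-congʳ {F} cₛ∘suc≈1) (*-identityˡ F) r s))
    (ℚₚ.+-identityˡ _)
    where
    cₛ∘suc≈1 : cₛ ∘ suc ≈ 1#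
    cₛ∘suc≈1 zero    zero    = ≡.refl
    cₛ∘suc≈1 zero    (suc _) = ≡.refl
    cₛ∘suc≈1 (suc _) _       = ≡.refl

  t-row : ∀ F r s → (tₛ * F) r s ≡ ℚ[[t]].conv (tₛ 0) (F r) s
  t-row F zero    s = ≡.refl
  t-row F (suc r) s = ≡.trans
    (≡.cong (ℚ[[t]].conv (tₛ 0) (F (suc r)) s +ℚ_)
      (trans (*-congʳ {F} {tₛ ∘ suc} {0#} (λ _ _ → ≡.refl)) (zeroˡ F) r s))
    (ℚₚ.+-identityʳ _)

  t*-zero : ∀ F r → (tₛ * F) r 0 ≡ 0ℚ
  t*-zero F r = ≡.trans (t-row F r 0) (ℚₚ.*-zeroˡ (F r 0))

  t*-suc : ∀ F r s → (tₛ * F) r (suc s) ≡ F r s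
  t*-suc F r s = ≡.trans (t-row F r (suc s)) (≡.trans
    (≡.cong₂ _+ℚ_ (ℚₚ.*-zeroˡ (F r (suc s)))
      (≡.trans (ℚ[[t]].conv-cong {g = F r} {g′ = F r} t∘suc≈1 (λ _ → ≡.refl) s) (ℚ[[t]].conv-identityˡ (F r) s)))
    (ℚₚ.+-identityˡ _))
    where
    t∘suc≈1 : ∀ n → tₛ 0 (suc n) ≡ ℚ[[t]].one n
    t∘suc≈1 zero    = ≡.refl
    t∘suc≈1 (suc _) = ≡.refl

  c/[1+c] : Series
  c/[1+c] = cₛ * 1/[1+c]

  c/[1+c]-unfold : c/[1+c] + cₛ * c/[1+c] ≈ cₛ
  c/[1+c]-unfold = begin
    cₛ * 1/[1+c] + cₛ * (cₛ * 1/[1+c]) ≈⟨ distribˡ cₛ 1/[1+c] (cₛ * 1/[1+c]) ⟨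
    cₛ * (1/[1+c] + cₛ * 1/[1+c])      ≈⟨ *-congˡ {cₛ} (+-congʳ {cₛ * 1/[1+c]} (*-identityˡ 1/[1+c])) ⟨
    cₛ * (1# * 1/[1+c] + cₛ * 1/[1+c]) ≈⟨ *-congˡ {cₛ} (distribʳ 1/[1+c] 1# cₛ) ⟨
    cₛ * ((1# + cₛ) * 1/[1+c])         ≈⟨ *-congˡ {cₛ} (*-congʳ {1/[1+c]} (+-congʳ {cₛ} 1ₛ≈1)) ⟨
    cₛ * ((1ₛ + cₛ) * 1/[1+c])         ≈⟨ *-congˡ {cₛ} (*ₛ≈* (1ₛ +ₛ cₛ) 1/[1+c]) ⟨
    cₛ * ((1ₛ +ₛ cₛ) *ₛ 1/[1+c])       ≈⟨ *-congˡ {cₛ} (trans 1/[1+c]-inverse 1ₛ≈1) ⟩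
    cₛ * 1#                            ≈⟨ *-identityʳ cₛ ⟩
    cₛ                                 ∎
    where open SetoidReasoning setoid

  c/[1+c]*-zero : ∀ F s → (c/[1+c] * F) 0 s ≡ 0ℚ
  c/[1+c]*-zero F s = ≡.trans (*-assoc cₛ 1/[1+c] F 0 s) (c*-zero (1/[1+c] * F) s)

  -- The relation X + cX = cF for X = c/(1+c) F, coefficient by coefficient. This is the form in
  -- which words beginning with `c k` are counted, without subtraction.
  c/[1+c]*-suc : ∀ F r s → (c/[1+c] * F) (suc r) s +ℚ (c/[1+c] * F) r s ≡ F r s
  c/[1+c]*-suc F r s = ≡.trans
    (≡.cong ((c/[1+c] * F) (suc r) s +ℚ_) (≡.sym (c*-suc (c/[1+c] * F) r s)))
    (≡.trans (unfolded (suc r) s) (c*-suc F r s))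
    where
    unfolded : c/[1+c] * F + cₛ * (c/[1+c] * F) ≈ cₛ * F
    unfolded = trans (+-congˡ {c/[1+c] * F} (sym (*-assoc cₛ c/[1+c] F)))
      (trans (sym (distribʳ F c/[1+c] (cₛ * c/[1+c]))) (*-congʳ {F} c/[1+c]-unfold))

  Φ : Series → Series
  Φ F = 1# + c/[1+c] * (F * F) + tₛ * (F * F * F)

  equation≈Φ : ∀ F → 1ₛ +ₛ cₛ *ₛ 1/[1+c] *ₛ (F *ₛ F) +ₛ tₛ *ₛ (F *ₛ F *ₛ F) ≈ Φ F
  equation≈Φ F = +-cong {1ₛ +ₛ cₛ *ₛ 1/[1+c] *ₛ (F *ₛ F)} {1# + c/[1+c] * (F * F)}
    (+-cong 1ₛ≈1 (trans (*ₛ≈* (cₛ *ₛ 1/[1+c]) (F *ₛ F)) (*-cong (*ₛ≈* cₛ 1/[1+c]) F²)))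
    (trans (*ₛ≈* tₛ (F *ₛ F *ₛ F)) (*-congˡ {tₛ} (trans (*ₛ≈* (F *ₛ F) F) (*-congʳ {F} F²))))
    where
    F² : F *ₛ F ≈ F * F
    F² = *ₛ≈* F F

  infix 4 _≈[_]_
  -- Congruence modulo the n-th power of the ideal (c, t), which measures how far two series agree.
  _≈[_]_ : Series → ℕ → Series → Set
  F ≈[ n ] G = ∀ r s → r ℕ.+ s ℕ.< n → F r s ≡ G r s

  *-cong-≈[] : ∀ {n F F′ G G′} → F ≈[ n ] F′ → G ≈[ n ] G′ → F * G ≈[ n ] F′ * G′
  *-cong-≈[] {n} {F} {F′} {G} {G′} p q r s r+s<n = ≡.trans (≡.sym (*ₛ≈* F G r s)) (≡.trans
    (sum-cong-≗ {suc r} λ i → sum-cong-≗ {suc s} λ j → ≡.cong₂ _*ℚ_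
      (p (toℕ i) (toℕ j) (ℕₚ.≤-<-trans (ℕₚ.+-mono-≤ (toℕ≤pred[n] i) (toℕ≤pred[n] j)) r+s<n))
      (q (r ∸ toℕ i) (s ∸ toℕ j) (ℕₚ.≤-<-trans (ℕₚ.+-mono-≤ (ℕₚ.m∸n≤m r (toℕ i)) (ℕₚ.m∸n≤m s (toℕ j))) r+s<n)))
    (*ₛ≈* F′ G′ r s))

  c*-contracts : ∀ {n F G} → F ≈[ n ] G → cₛ * F ≈[ suc n ] cₛ * G
  c*-contracts {F = F} {G} p zero    s _           = ≡.trans (c*-zero F s) (≡.sym (c*-zero G s))
  c*-contracts {F = F} {G} p (suc r) s (s≤s r+s<n) =
    ≡.trans (c*-suc F r s) (≡.trans (p r s r+s<n) (≡.sym (c*-suc G r s)))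

  t*-contracts : ∀ {n F G} → F ≈[ n ] G → tₛ * F ≈[ suc n ] tₛ * G
  t*-contracts {n} {F} {G} p r zero    _     = ≡.trans (t*-zero F r) (≡.sym (t*-zero G r))
  t*-contracts {n} {F} {G} p r (suc s) r+s<n = ≡.trans (t*-suc F r s) (≡.trans
    (p r s (ℕₚ.≤-pred (≡.subst (ℕ._< suc n) (ℕₚ.+-suc r s) r+s<n))) (≡.sym (t*-suc G r s)))

  -- Each term of `Φ` that involves the argument carries a factor c or t, which gains one degree of
  -- agreement.
  Φ-contracts : ∀ {n F G} → F ≈[ n ] G → Φ F ≈[ suc n ] Φ G
  Φ-contracts {n} {F} {G} p r s r+s<n = ≡.cong₂ _+ℚ_
    -- Reassociating `c/[1+c]` exposes the factor `cₛ` that supplies the gain.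
    (≡.cong (ℚ[[c,t]].one r s +ℚ_) (≡.trans (*-assoc cₛ 1/[1+c] (F * F) r s) (≡.trans
      (c*-contracts {F = 1/[1+c] * (F * F)} {G = 1/[1+c] * (G * G)}
        (*-cong-≈[] {F = 1/[1+c]} {G = F * F} (λ _ _ _ → ≡.refl) F²) r s r+s<n)
      (≡.sym (*-assoc cₛ 1/[1+c] (G * G) r s)))))
    (t*-contracts {F = F * F * F} {G = G * G * G} (*-cong-≈[] {F = F * F} {G = F} F² p) r s r+s<n)
    where
    F² : F * F ≈[ n ] G * G
    F² = *-cong-≈[] {F = F} {G = F} p p

  fixed-unique : ∀ {F G} → F ≈ Φ F → G ≈ Φ G → F ≈ G
  fixed-unique {F} {G} p q r s = agree (suc (r ℕ.+ s)) r s ℕₚ.≤-refl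
    where
    agree : ∀ n → F ≈[ n ] G
    agree (suc n) r s r+s<n = ≡.trans (p r s) (≡.trans (Φ-contracts (agree n) r s r+s<n) (≡.sym (q r s)))

  Φⁿ : ℕ → Series
  Φⁿ zero    = 0#
  Φⁿ (suc n) = Φ (Φⁿ n)

  -- The limit of the iterates of `Φ` from 0: by contraction, a coefficient of total degree d is
  -- constant from the iterate d+1 on.
  T : Series
  T r s = Φⁿ (suc (r ℕ.+ s)) r s

  Φⁿ-stable : ∀ n k → Φⁿ n ≈[ n ] Φⁿ (n ℕ.+ k)
  Φⁿ-stable (suc n) k = Φ-contracts (Φⁿ-stable n k)

  Φⁿ≈T : ∀ n → Φⁿ n ≈[ n ] T
  Φⁿ≈T n r s r+s<n with ℕₚ.m≤n⇒∃[o]m+o≡n r+s<n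
  ... | k , ≡.refl = ≡.sym (Φⁿ-stable (suc (r ℕ.+ s)) k r s ℕₚ.≤-refl)

  T-fixed : T ≈ Φ T
  T-fixed r s = Φ-contracts (Φⁿ≈T (r ℕ.+ s)) r s ℕₚ.≤-refl

  T^_ : ℕ → Series
  T^ zero  = 1#
  T^ suc k = T * (T^ k)

  -- The fixed-point equation multiplied by T^k; its terms correspond to `pathsBelow k`,
  -- `pathsFromC k` and `pathsFromT k`.
  T^-unfold : ∀ k → T^ suc k ≈ (T^ k) + c/[1+c] * (T^ (2 ℕ.+ k)) + tₛ * (T^ (3 ℕ.+ k))
  T^-unfold k = begin
    T * P
      ≈⟨ *-congʳ {P} T-fixed ⟩
    (1# + c/[1+c] * (T * T) + tₛ * (T * T * T)) * P
      ≈⟨ distribʳ P (1# + c/[1+c] * (T * T)) (tₛ * (T * T * T)) ⟩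
    (1# + c/[1+c] * (T * T)) * P + tₛ * (T * T * T) * P
      ≈⟨ +-cong (distribʳ P 1# (c/[1+c] * (T * T))) (*-assoc tₛ (T * T * T) P) ⟩
    1# * P + c/[1+c] * (T * T) * P + tₛ * (T * T * T * P)
      ≈⟨ +-cong {1# * P + c/[1+c] * (T * T) * P}
           (+-cong (*-identityˡ P) (trans (*-assoc c/[1+c] (T * T) P) (*-congˡ {c/[1+c]} (*-assoc T T P))))
           (*-congˡ {tₛ} (trans (*-assoc (T * T) T P) (*-assoc T T (T * P)))) ⟩
    P + c/[1+c] * (T * (T * P)) + tₛ * (T * (T * (T * P)))   ∎
    where
    P = T^ k
    open SetoidReasoning setoid

  ι : ℕ → ℚ
  ι n = + n / 1

  -- The fraction `+ n / 1` is normalised through a gcd and is stuck for a variable `n`, so the sum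
  -- is compared on unnormalised fractions.
  ι-+ : ∀ m n → ι (m ℕ.+ n) ≡ ι m +ℚ ι n
  ι-+ m n = ℚₚ.toℚᵘ-injective
    (ℚᵘₚ.≃-trans (ℚₚ.toℚᵘ-fromℚᵘ (mkℚᵘ (+ (m ℕ.+ n)) 0)) (ℚᵘₚ.≃-trans sum≃ (ℚᵘₚ.≃-sym
    (ℚᵘₚ.≃-trans (ℚₚ.toℚᵘ-homo-+ (ι m) (ι n))
      (ℚᵘₚ.+-cong (ℚₚ.toℚᵘ-fromℚᵘ (mkℚᵘ (+ m) 0)) (ℚₚ.toℚᵘ-fromℚᵘ (mkℚᵘ (+ n) 0)))))))
    where
    sum≃ : mkℚᵘ (+ (m ℕ.+ n)) 0 ≃ᵘ mkℚᵘ (+ m) 0 ℚᵘ.+ mkℚᵘ (+ n) 0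
    sum≃ = *≡* (≡.cong (ℤ._* + 1) (≡.sym (≡.cong₂ ℤ._+_ (ℤₚ.*-identityʳ (+ m)) (ℤₚ.*-identityʳ (+ n)))))

  satisfies⇒fixed : ∀ {F} → SatisfiesEquation F → F ≈ Φ F
  satisfies⇒fixed {F} eq = trans eq (equation≈Φ F)

  fixed⇒satisfies : ∀ {F} → F ≈ Φ F → SatisfiesEquation F
  fixed⇒satisfies {F} eq = trans eq (sym (equation≈Φ F))

  T^1 : T^ 1 ≈ T
  T^1 = *-identityʳ T

  ≈T⇒fixed : ∀ {F} → F ≈ T → F ≈ Φ F
  ≈T⇒fixed {F} F≈T = trans F≈T (trans T-fixed (Φ-cong (sym F≈T)))
    where
    Φ-cong : ∀ {F G} → F ≈ G → Φ F ≈ Φ G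
    Φ-cong F≈G r s = Φ-contracts (λ r s _ → F≈G r s) r s ℕₚ.≤-refl

-- Enumeration of the normal skeleton words

open SeriesEquation hiding (_≈_; trans; sym)
open import Data.Nat using (_+_)
open ≡ using (refl; sym; trans; cong; cong₂; subst; subst₂; resp₂)

start end : Letter → ℕ
start (c i) = i
start (t i) = i
end (c i) = i
end (t i) = suc i

start≤end : ∀ x → start x ≤ end x
start≤end (c i) = ℕₚ.≤-refl
start≤end (t i) = ℕₚ.n≤1+n i

Below : ℕ → Letter → Set
Below k x = start x ℕ.< k

-- In both cases the bound is `2 + end x`, that is, the negation of `x ≪ y`; after a clone set a
-- repetition is excluded as well.
Follow : Letter → Letter → Set
Follow (c i) y = Below (2 + i) y × y ≢ c i
Follow (t i) y = Below (3 + i) y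

-- The parameter constrains the first letter only, so one type serves both for an initial bound and
-- for the condition imposed by a preceding letter.
data Path (A : Letter → Set) : Word → Set where
  []  : Path A []
  _∷_ : ∀ {x w} → A x → Path (Follow x) w → Path A (x ∷ w)

Path-map : ∀ {A B} → (∀ {x} → A x → B x) → ∀ {w} → Path A w → Path B w
Path-map f []      = []
Path-map f (a ∷ p) = f a ∷ p

-- The level bound may rise by up to three, but only after a letter has been consumed; otherwise it
-- falls. This makes the recursion terminate.
pathsBelow pathsAfterC pathsFromC pathsFromT : ℕ → ℕ → ℕ → List Word
pathsBelow zero    zero    zero    = [] ∷ []
pathsBelow zero    zero    (suc _) = []
pathsBelow zero    (suc _) _       = []
pathsBelow (suc k) r       s       = (pathsBelow k r s ++ pathsFromC k r s) ++ pathsFromT k r s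
pathsFromC k zero    s = []
pathsFromC k (suc r) s = map (c k ∷_) (pathsAfterC k r s)
pathsFromT k r zero    = []
pathsFromT k r (suc s) = map (t k ∷_) (pathsBelow (3 + k) r s)
-- The two top steps of `pathsBelow (2 + k)` are written out so that the summand `pathsFromC k` can
-- be left out.
pathsAfterC k r s =
  (pathsBelow k r s ++ pathsFromT k r s) ++ (pathsFromC (suc k) r s ++ pathsFromT (suc k) r s)

Sized : ℕ → ℕ → Word → Set
Sized r s w = #c w ≡ r × #t w ≡ s

pathsBelow-sound  : ∀ k r s {w} → w ∈ˡ pathsBelow k r s → Path (Below k) w × Sized r s w
pathsAfterC-sound : ∀ k r s {w} → w ∈ˡ pathsAfterC k r s → Path (Follow (c k)) w × Sized r s w
pathsFromC-sound  : ∀ k r s {w} → w ∈ˡ pathsFromC k r s → Path (_≡ c k) w × Sized r s w × head w ≡ just (c k)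
pathsFromT-sound  : ∀ k r s {w} → w ∈ˡ pathsFromT k r s → Path (_≡ t k) w × Sized r s w × head w ≡ just (t k)
pathsBelow-sound zero zero zero (here refl) = [] , refl , refl
pathsBelow-sound (suc k) r s w∈ with ∈-++⁻ (pathsBelow k r s ++ pathsFromC k r s) w∈
... | inj₂ w∈T = let p , sz , _ = pathsFromT-sound k r s w∈T in Path-map (λ { refl → ℕₚ.≤-refl }) p , sz
... | inj₁ w∈PC with ∈-++⁻ (pathsBelow k r s) w∈PC
...   | inj₁ w∈P = let p , sz = pathsBelow-sound k r s w∈P in Path-map ℕₚ.m<n⇒m<1+n p , sz
...   | inj₂ w∈C = let p , sz , _ = pathsFromC-sound k r s w∈C in Path-map (λ { refl → ℕₚ.≤-refl }) p , sz
pathsFromC-sound k (suc r) s w∈ with ∈-map⁻ (c k ∷_) w∈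
... | w , w∈Y , refl = let p , r≡ , s≡ = pathsAfterC-sound k r s w∈Y in refl ∷ p , (cong suc r≡ , s≡) , refl
pathsFromT-sound k r (suc s) w∈ with ∈-map⁻ (t k ∷_) w∈
... | w , w∈P , refl = let p , r≡ , s≡ = pathsBelow-sound (3 + k) r s w∈P in refl ∷ p , (r≡ , cong suc s≡) , refl
pathsAfterC-sound k r s w∈ with ∈-++⁻ (pathsBelow k r s ++ pathsFromT k r s) w∈
... | inj₁ w∈PT with ∈-++⁻ (pathsBelow k r s) w∈PT
...   | inj₁ w∈P = let p , sz = pathsBelow-sound k r s w∈P in
                   Path-map (λ x<k → ℕₚ.m≤n⇒m≤1+n (ℕₚ.m≤n⇒m≤1+n x<k) , λ { refl → ℕₚ.<-irrefl refl x<k }) p , sz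
...   | inj₂ w∈T = let p , sz , _ = pathsFromT-sound k r s w∈T in
                   Path-map (λ { refl → ℕₚ.n≤1+n _ , λ () }) p , sz
pathsAfterC-sound k r s w∈ | inj₂ w∈CT with ∈-++⁻ (pathsFromC (suc k) r s) w∈CT
...   | inj₁ w∈C = let p , sz , _ = pathsFromC-sound (suc k) r s w∈C in
                   Path-map (λ { refl → ℕₚ.≤-refl , λ () }) p , sz
...   | inj₂ w∈T = let p , sz , _ = pathsFromT-sound (suc k) r s w∈T in
                   Path-map (λ { refl → ℕₚ.≤-refl , λ () }) p , sz

[]∈pathsBelow : ∀ k → [] ∈ˡ pathsBelow k 0 0
[]∈pathsBelow zero    = here refl
[]∈pathsBelow (suc k) = ∈-++⁺ˡ (∈-++⁺ˡ ([]∈pathsBelow k))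

pathsFromC⊆pathsBelow : ∀ {i k} r s {w} → i ℕ.< k → w ∈ˡ pathsFromC i r s → w ∈ˡ pathsBelow k r s
pathsFromC⊆pathsBelow {i} {suc k} r s i<k w∈ with ℕₚ.m<1+n⇒m<n∨m≡n i<k
... | inj₁ i<k′ = ∈-++⁺ˡ (∈-++⁺ˡ (pathsFromC⊆pathsBelow r s i<k′ w∈))
... | inj₂ refl = ∈-++⁺ˡ (∈-++⁺ʳ (pathsBelow k r s) w∈)

pathsFromT⊆pathsBelow : ∀ {i k} r s {w} → i ℕ.< k → w ∈ˡ pathsFromT i r s → w ∈ˡ pathsBelow k r s
pathsFromT⊆pathsBelow {i} {suc k} r s i<k w∈ with ℕₚ.m<1+n⇒m<n∨m≡n i<k
... | inj₁ i<k′ = ∈-++⁺ˡ (∈-++⁺ˡ (pathsFromT⊆pathsBelow r s i<k′ w∈))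
... | inj₂ refl = ∈-++⁺ʳ (pathsBelow k r s ++ pathsFromC k r s) w∈

pathsBelow-complete  : ∀ {k w} → Path (Below k) w → w ∈ˡ pathsBelow k (#c w) (#t w)
pathsAfterC-complete : ∀ {k w} → Path (Follow (c k)) w → w ∈ˡ pathsAfterC k (#c w) (#t w)
pathsBelow-complete {k} [] = []∈pathsBelow k
pathsBelow-complete (_∷_ {c i} {w} i<k p) =
  pathsFromC⊆pathsBelow _ _ i<k (∈-map⁺ (c i ∷_) (pathsAfterC-complete p))
pathsBelow-complete (_∷_ {t i} {w} i<k p) =
  pathsFromT⊆pathsBelow (#c w) _ i<k (∈-map⁺ (t i ∷_) (pathsBelow-complete p))
pathsAfterC-complete {k} [] = ∈-++⁺ˡ (∈-++⁺ˡ ([]∈pathsBelow k))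
pathsAfterC-complete {k} (_∷_ {c i} {w} (i<2+k , ≢) p) with ℕₚ.m<1+n⇒m<n∨m≡n i<2+k
... | inj₂ refl = ∈-++⁺ʳ (pathsBelow k (suc (#c w)) (#t w) ++ pathsFromT k (suc (#c w)) (#t w))
                         (∈-++⁺ˡ (∈-map⁺ (c i ∷_) (pathsAfterC-complete p)))
... | inj₁ i<1+k with ℕₚ.m<1+n⇒m<n∨m≡n i<1+k
...   | inj₂ refl = contradiction refl ≢
...   | inj₁ i<k  = ∈-++⁺ˡ (∈-++⁺ˡ (pathsFromC⊆pathsBelow _ _ i<k (∈-map⁺ (c i ∷_) (pathsAfterC-complete p))))
pathsAfterC-complete {k} (_∷_ {t i} {w} (i<2+k , ≢) p) with ℕₚ.m<1+n⇒m<n∨m≡n i<2+k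
... | inj₂ refl = ∈-++⁺ʳ (pathsBelow k (#c w) (suc (#t w)) ++ pathsFromT k (#c w) (suc (#t w)))
                         (∈-++⁺ʳ (pathsFromC (suc k) (#c w) (suc (#t w))) (∈-map⁺ (t i ∷_) (pathsBelow-complete p)))
... | inj₁ i<1+k with ℕₚ.m<1+n⇒m<n∨m≡n i<1+k
...   | inj₂ refl = ∈-++⁺ˡ (∈-++⁺ʳ (pathsBelow k (#c w) (suc (#t w))) (∈-map⁺ (t i ∷_) (pathsBelow-complete p)))
...   | inj₁ i<k  = ∈-++⁺ˡ (∈-++⁺ˡ (pathsFromT⊆pathsBelow (#c w) _ i<k (∈-map⁺ (t i ∷_) (pathsBelow-complete p))))

Disjoint-++ˡ : ∀ xs {ys zs : List Word} → Disjoint xs zs → Disjoint ys zs → Disjoint (xs ++ ys) zs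
Disjoint-++ˡ xs xs#zs ys#zs (v∈xys , v∈zs) =
  [ (λ v∈ → xs#zs (v∈ , v∈zs)) , (λ v∈ → ys#zs (v∈ , v∈zs)) ]′ (∈-++⁻ xs v∈xys)

below#headed : ∀ k r s {x ws} → k ≤ start x → (∀ {w} → w ∈ˡ ws → head w ≡ just x) →
               Disjoint (pathsBelow k r s) ws
below#headed k r s k≤x headed {[]} (_ , v∈) with headed v∈
... | ()
below#headed k r s k≤x headed {_ ∷ _} (v∈P , v∈) with headed v∈ | pathsBelow-sound k r s v∈P
... | refl | x<k ∷ _ , _ = ℕₚ.<⇒≱ x<k k≤x

headed#headed : ∀ {x y} {us vs : List Word} → x ≢ y → (∀ {w} → w ∈ˡ us → head w ≡ just x) →
                (∀ {w} → w ∈ˡ vs → head w ≡ just y) → Disjoint us vs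
headed#headed x≢y hx hy (v∈us , v∈vs) with trans (sym (hx v∈us)) (hy v∈vs)
... | refl = x≢y refl

headC : ∀ k r s {w} → w ∈ˡ pathsFromC k r s → head w ≡ just (c k)
headC k r s = proj₂ ∘ proj₂ ∘ pathsFromC-sound k r s

headT : ∀ k r s {w} → w ∈ˡ pathsFromT k r s → head w ≡ just (t k)
headT k r s = proj₂ ∘ proj₂ ∘ pathsFromT-sound k r s

pathsBelow-unique  : ∀ k r s → Unique (pathsBelow k r s)
pathsAfterC-unique : ∀ k r s → Unique (pathsAfterC k r s)
pathsFromC-unique  : ∀ k r s → Unique (pathsFromC k r s)
pathsFromT-unique  : ∀ k r s → Unique (pathsFromT k r s)
pathsBelow-unique zero    zero    zero    = [] ∷ []
pathsBelow-unique zero    zero    (suc _) = []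
pathsBelow-unique zero    (suc _) _       = []
pathsBelow-unique (suc k) r       s       = Unique.++⁺
  (Unique.++⁺ (pathsBelow-unique k r s) (pathsFromC-unique k r s) (below#headed k r s ℕₚ.≤-refl (headC k r s)))
  (pathsFromT-unique k r s)
  (Disjoint-++ˡ (pathsBelow k r s) (below#headed k r s ℕₚ.≤-refl (headT k r s))
    (headed#headed (λ ()) (headC k r s) (headT k r s)))
pathsFromC-unique k zero    s = []
pathsFromC-unique k (suc r) s = Unique.map⁺ ∷-injectiveʳ (pathsAfterC-unique k r s)
pathsFromT-unique k r zero    = []
pathsFromT-unique k r (suc s) = Unique.map⁺ ∷-injectiveʳ (pathsBelow-unique (3 + k) r s)
pathsAfterC-unique k r s = Unique.++⁺
  (Unique.++⁺ (pathsBelow-unique k r s) (pathsFromT-unique k r s) (below#headed k r s ℕₚ.≤-refl (headT k r s)))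
  (Unique.++⁺ (pathsFromC-unique (suc k) r s) (pathsFromT-unique (suc k) r s)
    (headed#headed (λ ()) (headC (suc k) r s) (headT (suc k) r s)))
  (Disjoint-++ˡ (pathsBelow k r s)
    (#-++ʳ (below#headed k r s (ℕₚ.n≤1+n k) (headC (suc k) r s))
           (below#headed k r s (ℕₚ.n≤1+n k) (headT (suc k) r s)))
    (#-++ʳ (headed#headed (λ ()) (headT k r s) (headC (suc k) r s))
           (headed#headed (λ ()) (headT k r s) (headT (suc k) r s))))
  where
  #-++ʳ : ∀ {us vs} → Disjoint us (pathsFromC (suc k) r s) → Disjoint us vs →
          Disjoint us (pathsFromC (suc k) r s ++ vs)
  #-++ʳ p q (v∈us , v∈) = [ (λ v∈C → p (v∈us , v∈C)) , (λ v∈vs → q (v∈us , v∈vs)) ]′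
    (∈-++⁻ (pathsFromC (suc k) r s) v∈)

-- Restoring the summand omitted from `pathsAfterC` completes the list for the bound `2 + k`; this
-- is the recurrence for X k with the subtraction moved across.
afterC+fromC : ∀ k r s →
  length (pathsAfterC k r s) + length (pathsFromC k r s) ≡ length (pathsBelow (2 + k) r s)
afterC+fromC k r s = trans (cong (_+ C) split) (trans
  (rearrange (length (pathsBelow k r s)) (length (pathsFromT k r s))
    (length (pathsFromC (suc k) r s)) (length (pathsFromT (suc k) r s)) C)
  (sym split′))
  where
  C = length (pathsFromC k r s)
  rearrange : ∀ p t c′ t′ c → ((p + t) + (c′ + t′)) + c ≡ ((p + c + t) + c′) + t′
  rearrange = ℕ-Solver.solve-∀
  split : length (pathsAfterC k r s) ≡
    (length (pathsBelow k r s) + length (pathsFromT k r s)) +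
    (length (pathsFromC (suc k) r s) + length (pathsFromT (suc k) r s))
  split = trans (length-++ (pathsBelow k r s ++ pathsFromT k r s))
    (cong₂ _+_ (length-++ (pathsBelow k r s)) (length-++ (pathsFromC (suc k) r s)))
  split′ : length (pathsBelow (2 + k) r s) ≡
    ((length (pathsBelow k r s) + C + length (pathsFromT k r s)) + length (pathsFromC (suc k) r s)) +
    length (pathsFromT (suc k) r s)
  split′ = trans (length-++ (pathsBelow (suc k) r s ++ pathsFromC (suc k) r s))
    (cong (_+ length (pathsFromT (suc k) r s))
    (trans (length-++ (pathsBelow (suc k) r s)) (cong (_+ length (pathsFromC (suc k) r s))
    (trans (length-++ (pathsBelow k r s ++ pathsFromC k r s)) (cong (_+ length (pathsFromT k r s))
    (length-++ (pathsBelow k r s)))))))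

ι∣pathsBelow∣ : ∀ k r s → ι (length (pathsBelow k r s)) ≡ (T^ k) r s
ι∣pathsFromC∣ : ∀ k r s → ι (length (pathsFromC k r s)) ≡ (c/[1+c] * (T^ (2 + k))) r s
ι∣pathsFromT∣ : ∀ k r s → ι (length (pathsFromT k r s)) ≡ (tₛ * (T^ (3 + k))) r s
ι∣pathsBelow∣ zero    zero    zero    = refl
ι∣pathsBelow∣ zero    zero    (suc _) = refl
ι∣pathsBelow∣ zero    (suc _) _       = refl
ι∣pathsBelow∣ (suc k) r       s       = begin
  ι (length ((P ++ C) ++ U))
    ≡⟨ cong ι (trans (length-++ (P ++ C)) (cong (_+ length U) (length-++ P))) ⟩
  ι (length P + length C + length U)
    ≡⟨ trans (ι-+ (length P + length C) (length U)) (cong (_+ℚ ι (length U)) (ι-+ (length P) (length C))) ⟩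
  ι (length P) +ℚ ι (length C) +ℚ ι (length U)
    ≡⟨ cong₂ _+ℚ_ (cong₂ _+ℚ_ (ι∣pathsBelow∣ k r s) (ι∣pathsFromC∣ k r s)) (ι∣pathsFromT∣ k r s) ⟩
  (T^ k) r s +ℚ (c/[1+c] * (T^ (2 + k))) r s +ℚ (tₛ * (T^ (3 + k))) r s
    ≡⟨ T^-unfold k r s ⟨
  (T^ suc k) r s ∎
  where
  open ≡.≡-Reasoning
  P = pathsBelow k r s
  C = pathsFromC k r s
  U = pathsFromT k r s
ι∣pathsFromC∣ k zero    s = sym (c/[1+c]*-zero (T^ (2 + k)) s)
-- Only the sum of the coefficients at r+1 and r is known on either side; the one at r is known by
-- induction and cancels.
ι∣pathsFromC∣ k (suc r) s = ∙-cancelʳ (X r s) (ι (length (pathsFromC k (suc r) s))) (X (suc r) s) (begin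
  ι (length (map (c k ∷_) (pathsAfterC k r s))) +ℚ X r s
    ≡⟨ cong₂ _+ℚ_ (cong ι (length-map (c k ∷_) (pathsAfterC k r s))) (sym (ι∣pathsFromC∣ k r s)) ⟩
  ι (length (pathsAfterC k r s)) +ℚ ι (length (pathsFromC k r s))
    ≡⟨ ι-+ (length (pathsAfterC k r s)) (length (pathsFromC k r s)) ⟨
  ι (length (pathsAfterC k r s) + length (pathsFromC k r s))
    ≡⟨ cong ι (afterC+fromC k r s) ⟩
  ι (length (pathsBelow (2 + k) r s))
    ≡⟨ ι∣pathsBelow∣ (2 + k) r s ⟩
  (T^ (2 + k)) r s
    ≡⟨ c/[1+c]*-suc (T^ (2 + k)) r s ⟨
  X (suc r) s +ℚ X r s ∎)
  where
  open ≡.≡-Reasoning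
  open GroupProperties ℚₚ.+-0-group using (∙-cancelʳ)
  X : Series
  X = c/[1+c] * (T^ (2 + k))
ι∣pathsFromT∣ k r zero    = sym (t*-zero (T^ (3 + k)) r)
ι∣pathsFromT∣ k r (suc s) = trans (cong ι (length-map (t k ∷_) (pathsBelow (3 + k) r s)))
  (trans (ι∣pathsBelow∣ (3 + k) r s) (sym (t*-suc (T^ (3 + k)) r s)))

-- Normal forms in M

infix 4 _≪_ _≪?_
_≪_ : Letter → Letter → Set
x ≪ y = suc (end x) ℕ.< start y

_≪?_ : ∀ x y → Dec (x ≪ y)
x ≪? y = suc (end x) ℕ.<? start y

≪-trans : ∀ {x y z} → x ≪ y → y ≪ z → x ≪ z
≪-trans {y = y} x≪y y≪z = ℕₚ.<-trans x≪y (ℕₚ.≤-<-trans (start≤end y) (ℕₚ.<-trans (ℕₚ.n<1+n _) y≪z))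

≪-asym : ∀ {x y} → x ≪ y → ¬ y ≪ x
≪-asym {x} {y} x≪y y≪x =
  ℕₚ.<-irrefl refl (ℕₚ.<-≤-trans (≪-trans {x} {y} {x} x≪y y≪x) (ℕₚ.m≤n⇒m≤1+n (start≤end x)))

far⇒separated : ∀ k i j → k ≤ ∣ i - j ∣ → k + i ≤ j ⊎ k + j ≤ i
far⇒separated k i j k≤ with ℕₚ.≤-total i j
... | inj₁ i≤j = inj₁ (subst (k + i ≤_) (ℕₚ.m∸n+n≡m i≤j) (ℕₚ.+-monoˡ-≤ i (subst (k ≤_) (ℕₚ.m≤n⇒∣m-n∣≡n∸m i≤j) k≤)))
... | inj₂ j≤i = inj₂ (subst (k + j ≤_) (ℕₚ.m∸n+n≡m j≤i) (ℕₚ.+-monoˡ-≤ j (subst (k ≤_) (ℕₚ.m≤n⇒∣n-m∣≡n∸m j≤i) k≤)))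

separated⇒far : ∀ k {i j} → k + i ≤ j → k ≤ ∣ i - j ∣
separated⇒far k {i} {j} k+i≤j = subst (k ≤_) (sym (ℕₚ.m≤n⇒∣m-n∣≡n∸m (ℕₚ.≤-trans (ℕₚ.m≤n+m i k) k+i≤j)))
  (ℕₚ.m+n≤o⇒m≤o∸n k k+i≤j)

commutes⇒≪ : ∀ {x y} → Commutes x y → x ≪ y ⊎ y ≪ x
commutes⇒≪ (c-c {i} {j} far) = far⇒separated 2 i j far
commutes⇒≪ (t-t {i} {j} far) = far⇒separated 3 i j far
commutes⇒≪ (c-t {i} {j} (inj₁ i+2≤j)) = inj₁ (subst (_≤ j) (ℕₚ.+-comm i 2) i+2≤j)
commutes⇒≪ (c-t {i} {j} (inj₂ j+3≤i)) = inj₂ (subst (_≤ i) (ℕₚ.+-comm j 3) j+3≤i)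

-- The mixed commutation rule has the clone letter first, so `t i ≪ c j` yields only the reversed
-- pair.
≪⇒commutes : ∀ {x y} → x ≪ y → Commutes x y ⊎ Commutes y x
≪⇒commutes {c i} {c j} i≪j = inj₁ (c-c (separated⇒far 2 i≪j))
≪⇒commutes {c i} {t j} i≪j = inj₁ (c-t (inj₁ (subst (_≤ j) (ℕₚ.+-comm 2 i) i≪j)))
≪⇒commutes {t i} {c j} i≪j = inj₂ (c-t (inj₂ (subst (_≤ j) (ℕₚ.+-comm 3 i) i≪j)))
≪⇒commutes {t i} {t j} i≪j = inj₁ (t-t (separated⇒far 3 i≪j))

-- The commutation relation is the comparability relation of the interval order
-- ≪, so sorting adjacent commuting letters is confluent.
insert : Letter → Word → Word
insert x []      = x ∷ []
insert x (y ∷ w) with x ≪? y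
... | yes _ = y ∷ insert x w
... | no _  = x ∷ y ∷ w

nf : Word → Word
nf []      = []
nf (x ∷ w) = insert x (nf w)

insert-≪ : ∀ {x y} w → x ≪ y → insert x (y ∷ w) ≡ y ∷ insert x w
insert-≪ {x} {y} w x≪y with x ≪? y
... | yes _   = refl
... | no ¬x≪y = contradiction x≪y ¬x≪y

insert-≪̸ : ∀ {x y} w → ¬ x ≪ y → insert x (y ∷ w) ≡ x ∷ y ∷ w
insert-≪̸ {x} {y} w ¬x≪y with x ≪? y
... | yes x≪y = contradiction x≪y ¬x≪y
... | no _    = refl

-- If `y` moves past `z`, then so does `x`, by transitivity. In every other case both orders of
-- insertion leave `y` in front of `x`.
insert-comm-≪ : ∀ {x y} → x ≪ y → ∀ w → insert x (insert y w) ≡ insert y (insert x w)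
insert-comm-≪ {x} {y} x≪y [] =
  trans (insert-≪ [] x≪y) (sym (insert-≪̸ {y} {x} [] (≪-asym {x} {y} x≪y)))
insert-comm-≪ {x} {y} x≪y (z ∷ w) with y ≪? z | x ≪? z
... | yes y≪z | yes x≪z = trans (insert-≪ _ x≪z) (trans (cong (z ∷_) (insert-comm-≪ x≪y w)) (sym (insert-≪ _ y≪z)))
... | yes y≪z | no ¬x≪z = contradiction (≪-trans {x} {y} {z} x≪y y≪z) ¬x≪z
... | no ¬y≪z | yes x≪z = trans (insert-≪ _ x≪y) (trans (cong (y ∷_) (insert-≪ w x≪z)) (sym (insert-≪̸ _ ¬y≪z)))
... | no ¬y≪z | no ¬x≪z = trans (insert-≪ _ x≪y)
  (trans (cong (y ∷_) (insert-≪̸ w ¬x≪z)) (sym (insert-≪̸ {y} {x} _ (≪-asym {x} {y} x≪y))))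

nf-↝ : ∀ {u v} → u ↝ v → nf u ≡ nf v
nf-↝ (swap w xy) = [ (λ x≪y → insert-comm-≪ x≪y (nf w)) , (λ y≪x → sym (insert-comm-≪ y≪x (nf w))) ]′ (commutes⇒≪ xy)
nf-↝ (skip x u↝v) = cong (insert x) (nf-↝ u↝v)

nf-cong : ∀ {u v} → u ≈ᴹ v → nf u ≡ nf v
nf-cong = EqC.gfold ≡.isEquivalence nf nf-↝

∷-congᴹ : ∀ x {u v} → u ≈ᴹ v → x ∷ u ≈ᴹ x ∷ v
∷-congᴹ x = EqC.gmap (x ∷_) (skip x)

insert-≈ : ∀ x w → insert x w ≈ᴹ x ∷ w
insert-≈ x []      = ε
insert-≈ x (y ∷ w) with x ≪? y
... | no _    = ε
... | yes x≪y = ∷-congᴹ y (insert-≈ x w) ◅◅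
  [ (λ xy → bwd (swap w xy)) , (λ yx → fwd (swap w yx)) ]′ (≪⇒commutes x≪y) ◅ ε

nf-≈ : ∀ w → nf w ≈ᴹ w
nf-≈ []      = ε
nf-≈ (x ∷ w) = insert-≈ x (nf w) ◅◅ ∷-congᴹ x (nf-≈ w)

Follow⇒start≤ : ∀ x {y} → Follow x y → start y ≤ suc (end x)
Follow⇒start≤ (c i) (s≤s y≤ , _) = y≤
Follow⇒start≤ (t i) (s≤s y≤)     = y≤

-- Paths are fixed by `nf`, so equivalent paths are equal and the enumeration has no repetitions in
-- M.
nf-path : ∀ {A w} → Path A w → nf w ≡ w
nf-path [] = refl
nf-path (_∷_ {x} _ p) with nf-path p
nf-path (_∷_ {x} _ [])                      | _  = refl
nf-path (_∷_ {x} _ p@(_∷_ {y} {w} follow _)) | eq =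
  trans (cong (insert x) eq) (insert-≪̸ w (ℕₚ.≤⇒≯ (Follow⇒start≤ x follow)))

Normal : Word → Set
Normal = Linked (λ x y → ¬ x ≪ y)

-- When `x` passes `y`, the new neighbour of `y` is either its old one or `x`, and asymmetry of `≪`
-- settles the latter.
insert-normal : ∀ x {w} → Normal w → Normal (insert x w)
insert-normal x {[]} _ = [-]
insert-normal x {y ∷ w} n with x ≪? y
... | no ¬x≪y = ¬x≪y ∷ n
insert-normal x {y ∷ []}    n             | yes x≪y = ≪-asym {x} {y} x≪y ∷ [-]
insert-normal x {y ∷ z ∷ w} (¬y≪z ∷ n) | yes x≪y with x ≪? z | insert-normal x n
... | yes _ | n′ = ¬y≪z ∷ n′
... | no _  | n′ = ≪-asym {x} {y} x≪y ∷ n′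

nf-normal : ∀ w → Normal (nf w)
nf-normal []      = []
nf-normal (x ∷ w) = insert-normal x (nf-normal w)

-- From compatible listings to words

subsetOf : ∀ {n} {P : Pred (Fin n) 0ℓ} → (∀ x → Dec (P x)) → Subset n
subsetOf P? = tabulate (does ∘ P?)

∈-subsetOf : ∀ {n} {P : Pred (Fin n) 0ℓ} (P? : ∀ x → Dec (P x)) x → x ∈ subsetOf P? ⇔ P x
∈-subsetOf P? x = mk⇔ sound complete
  where
  sound : x ∈ subsetOf P? → _
  sound x∈ with P? x | trans (sym (lookup∘tabulate (does ∘ P?) x)) ([]=⇒lookup x∈)
  ... | yes px | _ = px
  complete : _ → x ∈ subsetOf P?
  complete px = lookup⇒[]= x _ (trans (lookup∘tabulate (does ∘ P?) x) (dec-true (P? x) px))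

module Listings {n : ℕ} (_<_ : Rel (Fin n) 0ℓ) where
  open FinitePoset _<_

  Remaining-anti : ∀ k l {x} → k ≤ l → Remaining l x → Remaining k x
  Remaining-anti k l k≤l rem with ℕₚ.m≤n⇒∃[o]m+o≡n k≤l
  ... | o , refl = go k o rem
    where
    go : ∀ k o {x} → Remaining (k + o) x → Remaining k x
    go k zero    rem = subst (λ m → Remaining m _) (ℕₚ.+-identityʳ k) rem
    go k (suc o) {x} rem = go k o (proj₁ (subst (λ m → Remaining m x) (ℕₚ.+-suc k o) rem))

  remaining≤level : ∀ k l {x} → Remaining k x → Level l x → k ≤ l
  remaining≤level k l rem lev with k ℕ.≤? l
  ... | yes k≤l = k≤l
  ... | no  k≰l = contradiction lev (proj₂ (Remaining-anti (suc l) k (ℕₚ.≰⇒> k≰l) rem))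

  level-unique : ∀ k l {x} → Level k x → Level l x → k ≡ l
  level-unique k l p q = ℕₚ.≤-antisym (remaining≤level k l (proj₁ p) q) (remaining≤level l k (proj₁ q) p)

  level-strict : ∀ k l {x y} → x < y → Level k x → Level l y → k ℕ.< l
  level-strict k l x<y p q with l ℕ.≤? k
  ... | yes l≤k = contradiction x<y (proj₂ q _ (Remaining-anti l k l≤k (proj₁ p)))
  ... | no  l≰k = ℕₚ.≰⇒> l≰k

  -- Compatibility for one ordered pair of parts, in both directions. Since it mentions no
  -- positions, it can be carried through a reordering.
  Before : Rel (Part n) 0ℓ
  Before X Y = ∀ a b → a ∈ elements X → b ∈ elements Y → ∀ k l → Level k a → Level l b →
    a < b ⇔ k ℕ.< l × b < a ⇔ l + 2 ≤ k

  Compatible : List (Part n) → Set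
  Compatible Xs = ∀ (i j : Fin (length Xs)) → i ≢ j →
    ∀ a b → a ∈ elements (lookup Xs i) → b ∈ elements (lookup Xs j) →
    ∀ k l → Level k a → Level l b →
    a < b ⇔ (k + 2 ≤ l ⊎ (k + 1 ≡ l × i <ᶠ j))

  <⇒far∨next : ∀ {k l} → k ℕ.< l → k + 2 ≤ l ⊎ k + 1 ≡ l
  <⇒far∨next {k} {l} k<l with ℕₚ.m≤n⇒m<n∨m≡n k<l
  ... | inj₁ 2+k≤l = inj₁ (subst (_≤ l) (ℕₚ.+-comm 2 k) 2+k≤l)
  ... | inj₂ 1+k≡l = inj₂ (trans (ℕₚ.+-comm k 1) 1+k≡l)

  far⇒< : ∀ {k l} → k + 2 ≤ l → k ℕ.< l
  far⇒< {k} {l} k+2≤l = ℕₚ.≤-trans (ℕₚ.n≤1+n (suc k)) (subst (_≤ l) (ℕₚ.+-comm k 2) k+2≤l)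

  next⇒< : ∀ {k l} → k + 1 ≡ l → k ℕ.< l
  next⇒< {k} refl = ℕₚ.≤-reflexive (ℕₚ.+-comm 1 k)

  All-lookup⁻ : ∀ {P : Pred (Part n) 0ℓ} Xs → (∀ i → P (lookup Xs i)) → All P Xs
  All-lookup⁻ []       p = []
  All-lookup⁻ (X ∷ Xs) p = p zero ∷ All-lookup⁻ Xs (p ∘ suc)

  compatible⇒before : ∀ Xs → Compatible Xs → AllPairs Before Xs
  compatible⇒before []       compat = []
  compatible⇒before (X ∷ Xs) compat =
    All-lookup⁻ Xs (λ j a b a∈ b∈ k l ka lb →
      mk⇔ ([ far⇒< , next⇒< ∘ proj₁ ]′ ∘ to (compat zero (suc j) (λ ()) a b a∈ b∈ k l ka lb))
          (from (compat zero (suc j) (λ ()) a b a∈ b∈ k l ka lb) ∘ [ inj₁ , (λ e → inj₂ (e , s≤s z≤n)) ]′ ∘ <⇒far∨next) ,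
      mk⇔ ([ id , (λ { (_ , ()) }) ]′ ∘ to (compat (suc j) zero (λ ()) b a b∈ a∈ l k lb ka))
          (from (compat (suc j) zero (λ ()) b a b∈ a∈ l k lb ka) ∘ inj₁))
    ∷ compatible⇒before Xs (λ i j i≢j a b a∈ b∈ k l ka lb →
      let e = compat (suc i) (suc j) (λ { refl → i≢j refl }) a b a∈ b∈ k l ka lb in
      mk⇔ ([ inj₁ , (λ { (e , s≤s i<j) → inj₂ (e , i<j) }) ]′ ∘ to e)
          (from e ∘ [ inj₁ , (λ { (e , i<j) → inj₂ (e , s≤s i<j) }) ]′))

  before⇒compatible : ∀ Xs → AllPairs Before Xs → Compatible Xs
  before⇒compatible (X ∷ Xs) _ zero zero i≢j = contradiction refl i≢j
  before⇒compatible (X ∷ Xs) (bs ∷ _) zero (suc j) _ a b a∈ b∈ k l ka lb =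
    mk⇔ ([ inj₁ , (λ e → inj₂ (e , s≤s z≤n)) ]′ ∘ <⇒far∨next ∘ to e) (from e ∘ [ far⇒< , next⇒< ∘ proj₁ ]′)
    where e = proj₁ (All.lookup bs (∈-lookup j) a b a∈ b∈ k l ka lb)
  before⇒compatible (X ∷ Xs) (bs ∷ _) (suc i) zero _ a b a∈ b∈ k l ka lb =
    mk⇔ (inj₁ ∘ to e) (from e ∘ [ id , (λ { (_ , ()) }) ]′)
    where e = proj₂ (All.lookup bs (∈-lookup i) b a b∈ a∈ l k lb ka)
  before⇒compatible (X ∷ Xs) (_ ∷ ap) (suc i) (suc j) i≢j a b a∈ b∈ k l ka lb =
    mk⇔ ([ inj₁ , (λ { (e , i<j) → inj₂ (e , s≤s i<j) }) ]′ ∘ to e)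
        (from e ∘ [ inj₁ , (λ { (e , s≤s i<j) → inj₂ (e , i<j) }) ]′)
    where e = before⇒compatible Xs ap i j (λ { refl → i≢j refl }) a b a∈ b∈ k l ka lb

  HasLetter-level : ∀ {X x a k} → HasLetter X x → a ∈ elements X → Level k a → start x ≤ k × k ≤ end x
  HasLetter-level {k = k} (clone-c {i = i} h) a∈ ka with level-unique k i ka (h _ a∈)
  ... | refl = ℕₚ.≤-refl , ℕₚ.≤-refl
  HasLetter-level {k = k} (tangle-t {i = i} h) a∈ ka with h _ a∈
  ... | inj₁ ia with level-unique k i ka ia
  ...   | refl = ℕₚ.≤-refl , ℕₚ.n≤1+n _
  HasLetter-level {k = k} (tangle-t {i = i} h) a∈ ka | inj₂ ia with level-unique k (suc i) ka ia
  ...   | refl = ℕₚ.n≤1+n _ , ℕₚ.≤-refl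

  HasLetter-hasLevel : ∀ {X x a} → HasLetter X x → a ∈ elements X → ∃[ k ] Level k a
  HasLetter-hasLevel (clone-c {i = i} h)  a∈ = i , h _ a∈
  HasLetter-hasLevel (tangle-t {i = i} h) a∈ = [ (λ l → i , l) , (λ l → suc i , l) ]′ (h _ a∈)

  -- The inequality carries the uniqueness of the listing along; two adjacent clone sets on one
  -- level will contradict it.
  Precedes : Rel (Part n) 0ℓ
  Precedes X Y = Before X Y × X ≢ Y

  -- All levels of `X` lie at least two below those of `Y`, and at that distance compatibility does
  -- not depend on which part is listed first.
  precedes-≪ : ∀ {X Y x y} → HasLetter X x → HasLetter Y y → x ≪ y → Precedes X Y → Precedes Y X
  precedes-≪ {X} {Y} {x} {y} hx hy x≪y (before , X≢Y) = before′ , X≢Y ∘ sym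
    where
    before′ : Before Y X
    before′ b a b∈ a∈ l k lb ka =
      mk⇔ (far⇒< ∘ to (proj₂ e)) (λ l<k → contradiction k<l (ℕₚ.<-asym l<k)) ,
      mk⇔ (λ _ → k+2≤l) (from (proj₁ e) ∘ far⇒<)
      where
      e = before a b a∈ b∈ k l ka lb
      k+2≤l : k + 2 ≤ l
      k+2≤l = subst (_≤ l) (ℕₚ.+-comm 2 k) (ℕₚ.≤-trans (s≤s (s≤s (proj₂ (HasLetter-level {k = k} hx a∈ ka))))
        (ℕₚ.≤-trans x≪y (proj₁ (HasLetter-level {k = l} hy b∈ lb))))
      k<l : k ℕ.< l
      k<l = far⇒< k+2≤l

  record Listed (Xs : List (Part n)) (w : Word) : Set where
    constructor _,_
    field
      letters : Pointwise HasLetter Xs w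
      precede : AllPairs Precedes Xs

  Listed-insert : ∀ {X x Xs w} → HasLetter X x → All (Precedes X) Xs → Listed Xs w →
                  ∃[ Ys ] X ∷ Xs ↭ Ys × Listed Ys (insert x w)
  Listed-insert {X} hx [] ([] , []) = X ∷ [] , ↭-refl , (hx ∷ []) , ([] ∷ [])
  Listed-insert {X} {x} {Y ∷ Xs} {y ∷ w} hx (XY ∷ XXs) (hy ∷ hw , YXs ∷ ap) with x ≪? y
  ... | no _    = X ∷ Y ∷ Xs , ↭-refl , (hx ∷ hy ∷ hw) , ((XY ∷ XXs) ∷ YXs ∷ ap)
  ... | yes x≪y with Listed-insert hx XXs (hw , ap)
  ...   | Ys , XXs↭Ys , (hYs , apYs) = Y ∷ Ys , ↭-trans (swap X Y ↭-refl) (prep Y XXs↭Ys) , (hy ∷ hYs) ,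
          (All-resp-↭ XXs↭Ys (precedes-≪ hx hy x≪y XY ∷ YXs) ∷ apYs)

  -- Each move of a letter during sorting is a move of its part, so the normal form is again the
  -- word of a listing of the same poset.
  Listed-nf : ∀ {Xs w} → Listed Xs w → ∃[ Ys ] Xs ↭ Ys × Listed Ys (nf w)
  Listed-nf ([] , [])             = [] , ↭-refl , [] , []
  Listed-nf (hx ∷ hw , bs ∷ ap) with Listed-nf (hw , ap)
  ... | Ys , Xs↭Ys , listed with Listed-insert hx (All-resp-↭ Xs↭Ys bs) listed
  ...   | Zs , XYs↭Zs , listed′ = Zs , ↭-trans (prep _ Xs↭Ys) XYs↭Zs , listed′

  -- Words of a complete listing

  module _ (_<?_ : Decidable _<_) {Xs : List (Part n)} (parts : ∀ X → X ∈ˡ Xs ⇔ IsPart X) where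

    ⊆-dec : ∀ {P Q : Pred (Fin n) 0ℓ} → (∀ x → Dec (P x)) → (∀ x → Dec (Q x)) → Dec (P ⊆ Q)
    ⊆-dec P? Q? = map′ (λ f {x} → f x) (λ f x → f {x}) (all? λ x → P? x →-dec Q? x)

    _≈?_ : Decidable _≈_
    a ≈? b = (⊆-dec (_<? a) (_<? b) ×-dec ⊆-dec (_<? b) (_<? a)) ×-dec
             (⊆-dec (a <?_) (b <?_) ×-dec ⊆-dec (b <?_) (a <?_))

    -- `InNoTangle` quantifies over all pairs of subsets; a search through the listed parts decides
    -- it.
    InTangle : Fin n → Part n → Set
    InTangle x (cloneSet _) = Empty.⊥
    InTangle x (tangle A B) = x ∈ A ∪ B

    inTangle? : ∀ x X → Dec (InTangle x X)
    inTangle? x (cloneSet _) = no id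
    inTangle? x (tangle A B) = x ∈? A ∪ B

    noTangle⇔ : ∀ x → (¬ Any (InTangle x) Xs) ⇔ InNoTangle x
    noTangle⇔ x = mk⇔ (λ ¬any A B tan x∈ → ¬any (lose (from (parts (tangle A B)) tan) x∈))
      (λ none any → go none (find any))
      where
      go : InNoTangle x → ∃[ X ] X ∈ˡ Xs × InTangle x X → Empty.⊥
      go none (tangle A B , X∈ , x∈) = none A B (to (parts (tangle A B)) X∈) x∈

    -- An element missing from all listed parts would be in no tangle, so its class under `≈` is a
    -- clone set and is listed after all.
    covered : ∀ x → ∃[ X ] X ∈ˡ Xs × x ∈ elements X
    covered x with any? (λ X → x ∈? elements X) Xs
    ... | yes x∈Xs = find x∈Xs
    ... | no  x∉Xs = cloneSet C , from (parts (cloneSet C)) isClone , from (∈C x) (notInTangle , ≈-refl)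
      where
      clone? : ∀ y → Dec ((¬ Any (InTangle y) Xs) × x ≈ y)
      clone? y = ¬? (any? (inTangle? y) Xs) ×-dec (x ≈? y)
      C = subsetOf clone?
      ∈C = ∈-subsetOf clone?
      ≈-refl : x ≈ x
      ≈-refl = (id , id) , (id , id)
      notInTangle : ¬ Any (InTangle x) Xs
      notInTangle any with find any
      ... | tangle A B , X∈ , x∈ = x∉Xs (lose X∈ x∈)
      isClone : IsCloneSet C
      isClone = x , to (noTangle⇔ x) notInTangle , λ y →
        mk⇔ (λ y∈ → let nt , x≈y = to (∈C y) y∈ in to (noTangle⇔ y) nt , x≈y)
            (λ (nt , x≈y) → from (∈C y) (from (noTangle⇔ y) nt , x≈y))

    letterOf : ∀ {Ys w} → Pointwise HasLetter Ys w → ∀ {Y} → Y ∈ˡ Ys → ∃[ y ] HasLetter Y y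
    letterOf (hx ∷ _) (here refl) = _ , hx
    letterOf (_ ∷ hw) (there Y∈)  = letterOf hw Y∈

    -- In a tangle the matched bottom is strictly below its top, and with only two levels available
    -- it sits on the lower one.
    base : ∀ {X x} → IsPart X → HasLetter X x → ∃[ a ] a ∈ elements X × Level (start x) a
    base (a , nt , ∈C) (clone-c h) = a , a∈ , h a a∈
      where a∈ = from (∈C a) (nt , (id , id) , (id , id))
    base {tangle A B} (_ , _ , a , _ , b , _ , a∈ , _ , _ , b∈ , _ , _ , b<a , _) (tangle-t {i = i} h) = b , b∈′ , level-b
      where
      a∈′ = x∈p∪q⁺ {p = A} {q = B} (inj₁ a∈)
      b∈′ = x∈p∪q⁺ {p = A} {q = B} (inj₂ b∈)
      level-b : Level i b
      level-b with h b b∈′ | h a a∈′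
      ... | inj₁ ib  | _        = ib
      ... | inj₂ i+b | inj₁ ia  = contradiction (level-strict (suc i) i b<a i+b ia) (ℕₚ.<⇒≱ (ℕₚ.m<n⇒m<1+n (ℕₚ.n<1+n i)))
      ... | inj₂ i+b | inj₂ i+a = contradiction (level-strict (suc i) (suc i) b<a i+b i+a) (ℕₚ.<-irrefl refl)

    module _ {w : Word} (listed : Listed Xs w) where
      open Listed listed

      hasLevel : ∀ x → ∃[ k ] Level k x
      hasLevel x = let X , X∈ , x∈ = covered x in HasLetter-hasLevel (proj₂ (letterOf letters X∈)) x∈

      -- The invariant of the walk along the listing: every part already passed comes before all
      -- that remain.
      Suffix : List (Part n) → Set
      Suffix Ys = ∀ Z → Z ∈ˡ Xs → Z ∈ˡ Ys ⊎ All (λ Y → Before Z Y) Ys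

      Suffix-tail : ∀ {Y Ys} → All (Precedes Y) Ys → Suffix (Y ∷ Ys) → Suffix Ys
      Suffix-tail YYs suffix Z Z∈ with suffix Z Z∈
      ... | inj₁ (here refl) = inj₂ (All.map proj₁ YYs)
      ... | inj₁ (there Z∈′) = inj₁ Z∈′
      ... | inj₂ (_ ∷ ZYs)   = inj₂ ZYs

      -- Any third part is listed before both or after both, so `Before` gives it the same relation
      -- to `a` as to `b`; elements of the two sets themselves share a level and are incomparable to
      -- both.
      adjacent-≈ : ∀ {C C′ Ys i a b} → All (Precedes (cloneSet C)) Ys → All (Precedes (cloneSet C′)) Ys →
        Suffix (cloneSet C ∷ cloneSet C′ ∷ Ys) → HasLetter (cloneSet C) (c i) → HasLetter (cloneSet C′) (c i) →
        a ∈ C → b ∈ C′ → a ≈ b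
      adjacent-≈ {C} {C′} {Ys} {i} {a} {b} CYs C′Ys suffix (clone-c h) (clone-c h′) a∈ b∈ =
        ((λ {y} → to (proj₁ (same y))) , (λ {y} → from (proj₁ (same y)))) ,
        ((λ {y} → to (proj₂ (same y))) , (λ {y} → from (proj₂ (same y))))
        where
        ia = h a a∈
        ib = h′ b b∈
        equal : ∀ {y} → Level i y → (y < a ⇔ y < b) × (a < y ⇔ b < y)
        equal iy = mk⇔ (absurd iy ia) (absurd iy ib) , mk⇔ (absurd ia iy) (absurd ib iy)
          where
          absurd : ∀ {A : Set} {x y} → Level i x → Level i y → x < y → A
          absurd ix iy x<y = contradiction (level-strict i i x<y ix iy) (ℕₚ.<-irrefl refl)
        same : ∀ y → (y < a ⇔ y < b) × (a < y ⇔ b < y)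
        same y with covered y
        ... | Z , Z∈ , y∈ with suffix Z Z∈ | hasLevel y
        ...   | inj₁ (here refl)         | _ = equal (h y y∈)
        ...   | inj₁ (there (here refl)) | _ = equal (h′ y y∈)
        ...   | inj₁ (there (there Z∈′)) | l , ly =
                let a<y , y<a = proj₁ (All.lookup CYs Z∈′) a y a∈ y∈ i l ia ly
                    b<y , y<b = proj₁ (All.lookup C′Ys Z∈′) b y b∈ y∈ i l ib ly
                in mk⇔ (from y<b ∘ to y<a) (from y<a ∘ to y<b) , mk⇔ (from b<y ∘ to a<y) (from a<y ∘ to b<y)
        ...   | inj₂ (ZC ∷ ZC′ ∷ _) | l , ly =
                let y<a , a<y = ZC y a y∈ a∈ l i ly ia
                    y<b , b<y = ZC′ y b y∈ b∈ l i ly ib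
                in mk⇔ (from y<b ∘ to y<a) (from y<a ∘ to y<b) , mk⇔ (from b<y ∘ to a<y) (from a<y ∘ to b<y)

      adjacent-clones-distinct : ∀ {C C′ Ys i} → All (Precedes (cloneSet C)) (cloneSet C′ ∷ Ys) →
        All (Precedes (cloneSet C′)) Ys → Suffix (cloneSet C ∷ cloneSet C′ ∷ Ys) →
        IsCloneSet C → IsCloneSet C′ → HasLetter (cloneSet C) (c i) → ¬ HasLetter (cloneSet C′) (c i)
      adjacent-clones-distinct {C} {C′} (CC′ ∷ CYs) C′Ys suffix (a , nta , ∈C) (b , ntb , ∈C′) h h′ =
        proj₂ CC′ (cong cloneSet (⊆-antisym
          (λ x∈ → let nt , a≈x = to (∈C _) x∈ in from (∈C′ _) (nt , ≈-trans (≈-sym a≈b) a≈x))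
          (λ x∈ → let nt , b≈x = to (∈C′ _) x∈ in from (∈C _) (nt , ≈-trans a≈b b≈x))))
        where
        ≈-refl : ∀ {x} → x ≈ x
        ≈-refl = (id , id) , (id , id)
        ≈-sym : ∀ {x y} → x ≈ y → y ≈ x
        ≈-sym ((d , d′) , (u , u′)) = (d′ , d) , (u′ , u)
        ≈-trans : ∀ {x y z} → x ≈ y → y ≈ z → x ≈ z
        ≈-trans ((d , d′) , (u , u′)) ((e , e′) , (v , v′)) = ((e ∘ d) , (d′ ∘ e′)) , ((v ∘ u) , (u′ ∘ v′))
        a≈b : a ≈ b
        a≈b = adjacent-≈ CYs C′Ys suffix h h′ (from (∈C a) (nta , ≈-refl)) (from (∈C′ b) (ntb , ≈-refl))

      suffix-path : ∀ {Y Ys y v} {A : Letter → Set} → A y →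
        Pointwise HasLetter (Y ∷ Ys) (y ∷ v) → AllPairs Precedes (Y ∷ Ys) →
        (∀ {Z} → Z ∈ˡ Y ∷ Ys → Z ∈ˡ Xs) → Suffix (Y ∷ Ys) → Normal (y ∷ v) → Path A (y ∷ v)
      suffix-path py (_ ∷ []) _ _ _ _ = py ∷ []
      suffix-path {Y} {Z ∷ Ys} {y} {z ∷ v} py (hy ∷ hz ∷ hv) (YYs ∷ ZYs ∷ ap) ⊆Xs suffix (¬y≪z ∷ normal) =
        py ∷ suffix-path (follow y z hy hz ¬y≪z) (hz ∷ hv) (ZYs ∷ ap) (⊆Xs ∘ there) (Suffix-tail YYs suffix) normal
        where
        follow : ∀ y z → HasLetter Y y → HasLetter Z z → ¬ y ≪ z → Follow y z
        follow (t i) z _ _ ¬y≪z = s≤s (ℕₚ.≮⇒≥ ¬y≪z)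
        follow (c i) z hy hz ¬y≪z = s≤s (ℕₚ.≮⇒≥ ¬y≪z) , λ { refl → distinct hy hz }
          where
          distinct : HasLetter Y (c i) → HasLetter Z (c i) → Empty.⊥
          distinct hy@(clone-c _) hz@(clone-c _) = adjacent-clones-distinct YYs ZYs suffix
            (to (parts Y) (⊆Xs (here refl))) (to (parts Z) (⊆Xs (there (here refl)))) hy hz

    -- Suppose `X` starts on level `suc i` and `a` is on that level. An element below `a` cannot lie
    -- in `X`, and in a later part only two levels down. So `a` is already minimal in `Remaining i`,
    -- which contradicts its level.
    first-start : ∀ {X Ys x v} → Xs ≡ X ∷ Ys → Listed Xs (x ∷ v) → start x ≡ 0
    first-start {X} {Ys} {x} refl listed@(hx ∷ hv , XYs ∷ ap) with start x in eq | base (to (parts X) (here refl)) hx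
    ... | zero  | _ = refl
    ... | suc i | a , a∈ , (rem , ¬ia) , min = ⊥-elim (¬ia (rem , minimal))
      where
      ia : Level (suc i) a
      ia = (rem , ¬ia) , min
      minimal : ∀ y → Remaining i y → ¬ y < a
      minimal y rem-y y<a with covered y | hasLevel listed y
      ... | Z , here refl , y∈ | l , ly =
            ℕₚ.<⇒≱ (level-strict l (suc i) y<a ly ia) (subst (_≤ l) eq (proj₁ (HasLetter-level {k = l} hx y∈ ly)))
      ... | Z , there Z∈ , y∈ | l , ly =
            ℕₚ.<⇒≱ (subst (_≤ suc i) (ℕₚ.+-comm l 2) (to (proj₂ (proj₁ (All.lookup XYs Z∈) a y a∈ y∈ (suc i) l ia ly)) y<a))
                   (s≤s (remaining≤level i l rem-y ly))

  listed-path : Decidable _<_ → ∀ {Xs} → (∀ X → X ∈ˡ Xs ⇔ IsPart X) →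
                ∀ {w} → Normal w → Listed Xs w → Path (Below 1) w
  listed-path _    {[]}    parts normal ([] , _)              = []
  listed-path _<?_ {_ ∷ _} parts normal listed@(hx ∷ hw , ap) =
    suffix-path _<?_ parts listed (s≤s (ℕₚ.≤-reflexive (first-start _<?_ parts refl listed)))
      (hx ∷ hw) ap id (λ _ → inj₁) normal

skeleton⇒path : ∀ {w} → IsSkeleton w → Path (Below 1) (nf w)
skeleton⇒path {w} (n , _<_ , isDec , _ , Xs , listing , v , letters , v≈w) =
  subst (Path (Below 1)) (nf-cong v≈w) (listed-path isDec._<?_ parts′ (nf-normal v) listed′)
  where
  open FinitePoset _<_ using (IsPart; module IsCompatibleListing)
  open Listings _<_
  open IsCompatibleListing listing
  module isDec = IsDecStrictPartialOrder isDec
  reordered : ∃[ Ys ] Xs ↭ Ys × Listed Ys (nf v)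
  reordered = Listed-nf (letters , AllPairs.zip (compatible⇒before Xs compatible , unique))
  Xs↭Ys = proj₁ (proj₂ reordered)
  listed′ = proj₂ (proj₂ reordered)
  parts′ : ∀ X → X ∈ˡ proj₁ reordered ⇔ IsPart X
  parts′ X = mk⇔ (to (parts X) ∘ ∈-resp-↭ (↭-sym Xs↭Ys)) (∈-resp-↭ Xs↭Ys ∘ from (parts X))

-- From words to posets

end≤1+start : ∀ x → end x ≤ suc (start x)
end≤1+start (c i) = ℕₚ.n≤1+n i
end≤1+start (t i) = ℕₚ.≤-refl

infix 4 _∋_
_∋_ : Letter → ℕ → Set
x ∋ j = start x ≤ j × j ≤ end x

-- A discrete intermediate value argument: a letter starts at most one level above the end of its
-- predecessor, so no level is skipped on the way up.
crossing : ∀ {A y w j} → Path A (y ∷ w) → start y ≤ j → ∀ q → j ℕ.< start (lookup (y ∷ w) q) →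
           ∃[ r ] r <ᶠ q × lookup (y ∷ w) r ∋ j
crossing _ y≤j zero j<y = contradiction y≤j (ℕₚ.<⇒≱ j<y)
crossing {y = y} {j = j} (_ ∷ p) y≤j (suc q) j<q with j ℕ.≤? end y
... | yes j≤y = zero , s≤s z≤n , y≤j , j≤y
crossing {y = y} {z ∷ w} (_ ∷ p@(follow ∷ _)) y≤j (suc q) j<q | no j≰y
  with crossing p (ℕₚ.≤-trans (Follow⇒start≤ y follow) (ℕₚ.≰⇒> j≰y)) q j<q
... | r , r<q , ∋j = suc r , s≤s r<q , ∋j

-- The next letter is not `c i`. If it starts below `i`, the path must cross level i-1 to return; if
-- it starts at `i`, it is `t i` and meets i+1; otherwise it starts at i+1.
afterC : ∀ {w i} → Path (Follow (c i)) w → ∀ q → lookup w q ≡ c i →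
         ∃[ r ] ∃[ j ] r <ᶠ q × lookup w r ∋ j × (j ≡ suc i ⊎ suc j ≡ i)
afterC ((_ , y≢c) ∷ _) zero q≡ = contradiction q≡ y≢c
afterC {y ∷ _} {i} path@((s≤s y≤1+i , y≢c) ∷ _) (suc q) q≡ with ℕₚ.<-cmp (start y) i
afterC {y ∷ _} {suc j} path (suc q) q≡ | tri< (s≤s y≤j) _ _
  with crossing path y≤j (suc q) (ℕₚ.≤-reflexive (sym (cong start q≡)))
... | r , r<q , ∋j = r , j , r<q , ∋j , inj₂ refl
afterC {c _ ∷ _} ((_ , y≢c) ∷ _) (suc q) _ | tri≈ _ refl _ = contradiction refl y≢c
afterC {t i ∷ _} _ (suc q) _ | tri≈ _ refl _ = zero , suc i , s≤s z≤n , (ℕₚ.n≤1+n i , ℕₚ.≤-refl) , inj₁ refl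
afterC {y ∷ _} {i} ((s≤s y≤1+i , _) ∷ _) (suc q) _ | tri> _ _ i<y =
  zero , suc i , s≤s z≤n , (y≤1+i , ℕₚ.≤-trans i<y (start≤end y)) , inj₁ refl

between : ∀ {A w i} → Path A w → ∀ p q → p <ᶠ q → lookup w p ≡ c i → lookup w q ≡ c i →
          ∃[ r ] ∃[ j ] p <ᶠ r × r <ᶠ q × lookup w r ∋ j × (j ≡ suc i ⊎ suc j ≡ i)
between (_ ∷ path) zero    (suc q) _         refl q≡ with afterC path q q≡
... | r , j , r<q , rest = suc r , j , s≤s z≤n , s≤s r<q , rest
between (_ ∷ path) (suc p) (suc q) (s≤s p<q) p≡   q≡ with between path p q p<q p≡ q≡
... | r , j , p<r , r<q , rest = suc r , j , s≤s p<r , s≤s r<q , rest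

height : Letter → Fin 2 → ℕ
height (c i) _ = i
height (t i) s = toℕ s + i

height-∋ : ∀ x s → x ∋ height x s
height-∋ (c i) _  = ℕₚ.≤-refl , ℕₚ.≤-refl
height-∋ (t i) 0F = ℕₚ.≤-refl , ℕₚ.n≤1+n i
height-∋ (t i) 1F = ℕₚ.n≤1+n i , ℕₚ.≤-refl

∋⇒height : ∀ x {j} → x ∋ j → ∃[ s ] height x s ≡ j
∋⇒height (c i) (i≤j , j≤i) = 0F , ℕₚ.≤-antisym i≤j j≤i
∋⇒height (t i) (i≤j , j≤1+i) with ℕₚ.m≤n⇒m<n∨m≡n i≤j
... | inj₁ i<j = 1F , ℕₚ.≤-antisym i<j j≤1+i
... | inj₂ i≡j = 0F , i≡j

two-elements : ∀ {n} {A : Subset n} {x y} → x ∈ A → y ∈ A → x ≢ y → 2 ≤ ∣ A ∣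
two-elements x∈ y∈ x≢y = ℕₚ.≤-trans
  (s≤s (ℕₚ.≤-trans (s≤s z≤n) (x∈p⇒∣p-x∣<∣p∣ (x∈p∧x≢y⇒x∈p-y x∈ x≢y)))) (x∈p⇒∣p-x∣<∣p∣ y∈)

-- Every letter contributes four vertices: four clones for a letter c, and two
-- edges b₀ < a₀, b₁ < a₁ for a letter t.  A vertex is given by the position of
-- its letter, its side (0F bottom, 1F top) and the index of its edge.
module Realisation (w : Word) (path : Path (Below 1) w) where

  m n : ℕ
  m = length w
  n = m ℕ.* 4

  abstract
    pos : Fin n → Fin m
    pos x = proj₁ (remQuot 4 x)

    side idx : Fin n → Fin 2
    side x = proj₁ (remQuot {2} 2 (proj₂ (remQuot {m} 4 x)))
    idx x  = proj₂ (remQuot {2} 2 (proj₂ (remQuot {m} 4 x)))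

    vertex : Fin m → Fin 2 → Fin 2 → Fin n
    vertex p s i = combine p (combine s i)

    pos-vertex : ∀ p s i → pos (vertex p s i) ≡ p
    pos-vertex p s i = cong proj₁ (Finₚ.remQuot-combine {m} {4} p (combine s i))

    slot-vertex : ∀ p s i → remQuot {2} 2 (proj₂ (remQuot {m} 4 (vertex p s i))) ≡ (s , i)
    slot-vertex p s i = trans (cong (remQuot {2} 2 ∘ proj₂) (Finₚ.remQuot-combine {m} {4} p (combine s i)))
      (Finₚ.remQuot-combine {2} {2} s i)

    vertex-η : ∀ x → vertex (pos x) (side x) (idx x) ≡ x
    vertex-η x = trans (cong (combine (pos x)) (Finₚ.combine-remQuot {2} 2 (proj₂ (remQuot {m} 4 x))))
      (Finₚ.combine-remQuot {m} 4 x)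

    side-vertex : ∀ p s i → side (vertex p s i) ≡ s
    side-vertex p s i = cong proj₁ (slot-vertex p s i)

    idx-vertex : ∀ p s i → idx (vertex p s i) ≡ i
    idx-vertex p s i = cong proj₂ (slot-vertex p s i)

  letter : Fin n → Letter
  letter x = lookup w (pos x)

  lev : Fin n → ℕ
  lev x = height (letter x) (side x)

  lev-vertex : ∀ p s i → lev (vertex p s i) ≡ height (lookup w p) s
  lev-vertex p s i = cong₂ (λ p s → height (lookup w p) s) (pos-vertex p s i) (side-vertex p s i)

  -- The order between consecutive levels. Its second alternative then concerns the edges of a
  -- tangle letter only, since all vertices of a letter `c i` share a level.
  Link : Rel (Fin n) 0ℓ
  Link x y = pos x <ᶠ pos y ⊎ (pos x ≡ pos y × idx x ≡ idx y)

  infix 4 _<_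
  -- Between different letters this is the order that compatibility prescribes, with `lev` in place
  -- of the level; `level⇔` shows that the two coincide.
  _<_ : Rel (Fin n) 0ℓ
  x < y = 2 + lev x ≤ lev y ⊎ (suc (lev x) ≡ lev y × Link x y)

  <⇒lev< : ∀ {x y} → x < y → lev x ℕ.< lev y
  <⇒lev< (inj₁ 2+x≤y)    = ℕₚ.≤-trans (ℕₚ.n≤1+n _) 2+x≤y
  <⇒lev< (inj₂ (1+x≡y , _)) = ℕₚ.≤-reflexive 1+x≡y

  <-next⇒link : ∀ {x y} → suc (lev x) ≡ lev y → x < y → Link x y
  <-next⇒link 1+x≡y (inj₁ 2+x≤y)   = contradiction (sym 1+x≡y) (ℕₚ.<⇒≢ 2+x≤y ∘ sym)
  <-next⇒link 1+x≡y (inj₂ (_ , l)) = l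

  link⇒pos≤ : ∀ {x y} → Link x y → toℕ (pos x) ≤ toℕ (pos y)
  link⇒pos≤ (inj₁ x<y)       = ℕₚ.<⇒≤ x<y
  link⇒pos≤ (inj₂ (x≡y , _)) = ℕₚ.≤-reflexive (cong toℕ x≡y)

  isDecStrictPartialOrder : IsDecStrictPartialOrder _≡_ _<_
  isDecStrictPartialOrder = record
    { isStrictPartialOrder = record
      { isEquivalence = ≡.isEquivalence
      ; irrefl = λ { refl x<x → ℕₚ.<-irrefl refl (<⇒lev< x<x) }
      -- Two strict steps climb at least two levels, where all pairs are comparable.
      ; trans = λ x<y y<z → inj₁ (ℕₚ.≤-trans (s≤s (<⇒lev< x<y)) (<⇒lev< y<z))
      ; <-resp-≈ = resp₂ _<_
      }
    ; _≟_ = Finₚ._≟_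
    ; _<?_ = λ x y → (2 + lev x ℕ.≤? lev y) ⊎-dec ((suc (lev x) ℕ.≟ lev y) ×-dec
        ((pos x Finₚ.<? pos y) ⊎-dec ((pos x Finₚ.≟ pos y) ×-dec (idx x Finₚ.≟ idx y))))
    }

  open FinitePoset _<_
  open Listings _<_

  start≤lev : ∀ x → start (letter x) ≤ lev x
  start≤lev x = proj₁ (height-∋ (letter x) (side x))

  lev≤end : ∀ x → lev x ≤ end (letter x)
  lev≤end x = proj₂ (height-∋ (letter x) (side x))

  same-pos⇒lev≤ : ∀ {x y} → pos x ≡ pos y → lev x ≤ suc (lev y)
  same-pos⇒lev≤ {x} {y} x≡y = ℕₚ.≤-trans (lev≤end x) (ℕₚ.≤-trans (end≤1+start (letter x))
    (s≤s (subst (λ p → start (lookup w p) ≤ lev y) (sym x≡y) (start≤lev y))))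

  ¬<⇒lev≤ : ∀ {x y} → ¬ x < y → lev y ≤ suc (lev x)
  ¬<⇒lev≤ ¬x<y = ℕₚ.≮⇒≥ (¬x<y ∘ inj₁)

  ¬<⇒pos≤ : ∀ {x y} → suc (lev x) ≡ lev y → ¬ x < y → toℕ (pos y) ≤ toℕ (pos x)
  ¬<⇒pos≤ 1+x≡y ¬x<y = ℕₚ.≮⇒≥ (λ x<y → ¬x<y (inj₂ (1+x≡y , inj₁ x<y)))

  -- Incomparability of `d` with both ends forces `y` and `d` onto one level, with `x` and `z` just
  -- below and above. The missing links give pos z ≤ pos d ≤ pos x, the chain gives pos x ≤ pos y ≤
  -- pos z, so one letter would meet three levels.
  ⟨3+1⟩-free : ⟨3+1⟩-Free
  ⟨3+1⟩-free (x , y , z , d , x<y , y<z , (_ , ¬d<x , ¬x<d) , _ , (_ , ¬d<z , ¬z<d)) =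
    ℕₚ.<-irrefl refl (ℕₚ.≤-trans (ℕₚ.≤-reflexive (trans (cong suc 1+x≡y) 1+y≡z)) (same-pos⇒lev≤ {z} {x} z≡x))
    where
    z≤2+x : lev z ≤ 2 + lev x
    z≤2+x = ℕₚ.≤-trans (¬<⇒lev≤ {d} {z} ¬d<z) (s≤s (¬<⇒lev≤ {x} {d} ¬x<d))
    1+x≡y : suc (lev x) ≡ lev y
    1+x≡y = ℕₚ.≤-antisym (<⇒lev< {x} {y} x<y) (ℕₚ.≤-pred (ℕₚ.≤-trans (<⇒lev< {y} {z} y<z) z≤2+x))
    1+y≡z : suc (lev y) ≡ lev z
    1+y≡z = ℕₚ.≤-antisym (<⇒lev< {y} {z} y<z) (subst (λ l → lev z ≤ suc l) 1+x≡y z≤2+x)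
    1+x≡d : suc (lev x) ≡ lev d
    1+x≡d = ℕₚ.≤-antisym
      (ℕₚ.≤-pred (ℕₚ.≤-trans (ℕₚ.≤-reflexive (trans (cong suc 1+x≡y) 1+y≡z)) (¬<⇒lev≤ {d} {z} ¬d<z)))
      (¬<⇒lev≤ {x} {d} ¬x<d)
    1+d≡z : suc (lev d) ≡ lev z
    1+d≡z = trans (cong suc (trans (sym 1+x≡d) 1+x≡y)) 1+y≡z
    z≡x : pos z ≡ pos x
    z≡x = Finₚ.toℕ-injective (ℕₚ.≤-antisym
      (ℕₚ.≤-trans (¬<⇒pos≤ {d} {z} 1+d≡z ¬d<z) (¬<⇒pos≤ {x} {d} 1+x≡d ¬x<d))
      (ℕₚ.≤-trans (link⇒pos≤ {x} {y} (<-next⇒link {x} {y} 1+x≡y x<y))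
        (link⇒pos≤ {y} {z} (<-next⇒link {y} {z} 1+y≡z y<z))))

  -- Heights are the levels of the poset

  vertexAt : ∀ p {j} → lookup w p ∋ j → ∃[ x ] pos x ≡ p × lev x ≡ j
  vertexAt p p∋j = let s , eq = ∋⇒height (lookup w p) p∋j in
    vertex p s 0F , pos-vertex p s 0F , trans (lev-vertex p s 0F) eq

  crossing₀ : ∀ {v j} → Path (Below 1) v → ∀ q → j ℕ.< start (lookup v q) → ∃[ r ] r <ᶠ q × lookup v r ∋ j
  crossing₀ p@(s≤s x≤0 ∷ _) q j<q = crossing p (ℕₚ.≤-trans x≤0 z≤n) q j<q

  -- A vertex at the start of its letter has an earlier letter meeting the level below, by
  -- `crossing₀`; any other vertex is the upper end of an edge and has the lower end below it.
  grounded : ∀ x {j} → lev x ≡ suc j → ∃[ y ] y < x × lev y ≡ j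
  grounded x {j} x≡1+j with ℕₚ.m≤n⇒m<n∨m≡n (start≤lev x)
  ... | inj₂ start≡lev with crossing₀ path (pos x) (ℕₚ.≤-reflexive (sym (trans start≡lev x≡1+j)))
  ...   | r , r<x , r∋j with vertexAt r r∋j
  ...     | y , refl , y≡j = y , inj₂ (trans (cong suc y≡j) (sym x≡1+j) , inj₁ r<x) , y≡j
  grounded x {j} x≡1+j | inj₁ start<lev =
    y , inj₂ (trans (cong suc y≡j) (sym x≡1+j) , inj₂ (pos-vertex _ 0F _ , idx-vertex _ 0F _)) , y≡j
    where
    y = vertex (pos x) 0F (idx x)
    height-0F : ∀ l → height l 0F ≡ start l
    height-0F (c _) = refl
    height-0F (t _) = refl
    y≡j : lev y ≡ j
    y≡j = trans (lev-vertex (pos x) 0F (idx x)) (trans (height-0F (letter x))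
      (ℕₚ.≤-antisym (ℕₚ.≤-pred (subst (start (letter x) ℕ.<_) x≡1+j start<lev))
        (ℕₚ.≤-pred (subst (_≤ suc (start (letter x))) x≡1+j (ℕₚ.≤-trans (lev≤end x) (end≤1+start (letter x)))))))

  ground : ∀ {k x} → k ℕ.< lev x → ∃[ y ] y < x × k ≤ lev y
  ground {k} {x} k<x with ℕₚ.m≤n⇒∃[o]m+o≡n k<x
  ... | o , 1+k+o≡x with grounded x (sym 1+k+o≡x)
  ...   | y , y<x , y≡k+o = y , y<x , subst (k ≤_) (sym y≡k+o) (ℕₚ.m≤m+n k o)

  remaining⇔ : ∀ k x → Remaining k x ⇔ k ≤ lev x
  level⇔ : ∀ k x → Level k x ⇔ lev x ≡ k
  remaining⇔ zero    x = mk⇔ (λ _ → z≤n) (λ _ → _)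
  remaining⇔ (suc k) x = mk⇔
    (λ (rem , ¬level) → ℕₚ.≤∧≢⇒< (to (remaining⇔ k x) rem) (λ k≡x → ¬level (from (level⇔ k x) (sym k≡x))))
    (λ k<x → from (remaining⇔ k x) (ℕₚ.<⇒≤ k<x) , λ level → ℕₚ.<⇒≢ k<x (sym (to (level⇔ k x) level)))
  level⇔ k x = mk⇔ level⇒ (λ x≡k → from (remaining⇔ k x) (ℕₚ.≤-reflexive (sym x≡k)) ,
      λ y rem y<x → ℕₚ.<⇒≱ (subst (lev y ℕ.<_) x≡k (<⇒lev< {y} {x} y<x)) (to (remaining⇔ k y) rem))
    where
    level⇒ : Level k x → lev x ≡ k
    level⇒ (rem , minimal) with ℕₚ.m≤n⇒m<n∨m≡n (to (remaining⇔ k x) rem)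
    ... | inj₂ k≡x = sym k≡x
    ... | inj₁ k<x with ground k<x
    ...   | y , y<x , k≤y = contradiction y<x (minimal y (from (remaining⇔ k y) k≤y))

  -- Tops and bottoms of tangles in the realisation

  IsUpper IsLower : Fin n → Set
  IsUpper x = start (letter x) ℕ.< lev x
  IsLower x = lev x ℕ.< end (letter x)

  upper-lev : ∀ {x} → IsUpper x → lev x ≡ end (letter x)
  upper-lev {x} up = ℕₚ.≤-antisym (lev≤end x) (ℕₚ.≤-trans (end≤1+start (letter x)) up)

  lower-lev : ∀ {x} → IsLower x → lev x ≡ start (letter x)
  lower-lev {x} low = ℕₚ.≤-antisym (ℕₚ.≤-pred (ℕₚ.≤-trans low (end≤1+start (letter x)))) (start≤lev x)

  D⊆-lev : ∀ {x y} → lev x ℕ.< lev y → D↓ x ⊆ D↓ y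
  D⊆-lev {x} x<y {z} z<x = inj₁ (ℕₚ.≤-trans (s≤s (<⇒lev< {z} {x} z<x)) x<y)

  U⊆-lev : ∀ {x y} → lev x ℕ.< lev y → U↑ y ⊆ U↑ x
  U⊆-lev {x} {y} x<y {z} y<z = inj₁ (ℕₚ.≤-trans (s≤s x<y) (<⇒lev< {y} {z} y<z))

  D⊆-link : ∀ {x y} → lev x ≡ lev y → (∀ z → suc (lev z) ≡ lev x → Link z x → Link z y) → D↓ x ⊆ D↓ y
  D⊆-link {x} {y} x≡y link (inj₁ 2+z≤x)          = inj₁ (subst (_ ≤_) x≡y 2+z≤x)
  D⊆-link {x} {y} x≡y link {z} (inj₂ (1+z≡x , l)) = inj₂ (trans 1+z≡x x≡y , link z 1+z≡x l)

  U⊆-link : ∀ {x y} → lev x ≡ lev y → (∀ z → suc (lev x) ≡ lev z → Link x z → Link y z) → U↑ x ⊆ U↑ y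
  U⊆-link {x} {y} x≡y link {z} (inj₁ 2+x≤z)       = inj₁ (subst (λ l → 2 + l ≤ lev z) x≡y 2+x≤z)
  U⊆-link {x} {y} x≡y link {z} (inj₂ (1+x≡z , l)) = inj₂ (trans (cong suc (sym x≡y)) 1+x≡z , link z 1+x≡z l)

  D⊆-pos : ∀ {x y} → lev x ≡ lev y → pos x <ᶠ pos y → D↓ x ⊆ D↓ y
  D⊆-pos {x} {y} x≡y px<py = D⊆-link {x} {y} x≡y λ z _ l → inj₁ (ℕₚ.≤-<-trans (link⇒pos≤ {z} {x} l) px<py)

  U⊆-pos : ∀ {x y} → lev x ≡ lev y → pos x <ᶠ pos y → U↑ y ⊆ U↑ x
  U⊆-pos {x} {y} x≡y px<py = U⊆-link {y} {x} (sym x≡y) λ z _ l → inj₁ (ℕₚ.<-≤-trans px<py (link⇒pos≤ {y} {z} l))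

  -- A vertex that is not upper has nothing below it inside its own letter, and other letters do not
  -- see the index of an edge.
  D⊆-same : ∀ {x y} → lev x ≡ lev y → pos x ≡ pos y → ¬ IsUpper x → D↓ x ⊆ D↓ y
  D⊆-same {x} {y} x≡y px≡py ¬upper = D⊆-link {x} {y} x≡y link
    where
    link : ∀ z → suc (lev z) ≡ lev x → Link z x → Link z y
    link z _     (inj₁ pz<px)           = inj₁ (subst (pos z <ᶠ_) px≡py pz<px)
    link z 1+z≡x (inj₂ (pz≡px , _))     = contradiction
          (ℕₚ.≤-trans (s≤s (subst (λ p → start (lookup w p) ≤ lev z) pz≡px (start≤lev z))) (ℕₚ.≤-reflexive 1+z≡x)) ¬upper

  U⊆-same : ∀ {x y} → lev x ≡ lev y → pos x ≡ pos y → ¬ IsLower x → U↑ x ⊆ U↑ y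
  U⊆-same {x} {y} x≡y px≡py ¬lower = U⊆-link {x} {y} x≡y link
    where
    link : ∀ z → suc (lev x) ≡ lev z → Link x z → Link y z
    link z _     (inj₁ px<pz)           = inj₁ (subst (_<ᶠ pos z) px≡py px<pz)
    link z 1+x≡z (inj₂ (px≡pz , _))     = contradiction
          (ℕₚ.≤-trans (ℕₚ.≤-reflexive 1+x≡z) (subst (λ p → lev z ≤ end (lookup w p)) (sym px≡pz) (lev≤end z))) ¬lower

  SameUpper SameLower : Rel (Fin n) 0ℓ
  SameUpper x y = pos x ≡ pos y × IsUpper x × IsUpper y
  SameLower x y = pos x ≡ pos y × IsLower x × IsLower y

  isUpper? : ∀ x → Dec (IsUpper x)
  isUpper? x = start (letter x) ℕ.<? lev x

  isLower? : ∀ x → Dec (IsLower x)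
  isLower? x = lev x ℕ.<? end (letter x)

  -- Down-sets grow with the level and, within a level, with the position; only the edges inside one
  -- letter can make two of them incomparable.
  ⊤⇒sameUpper : ∀ {x y} → x ⊤ y → SameUpper x y
  ⊤⇒sameUpper {x} {y} (¬Dx⊆Dy , ¬Dy⊆Dx) with ℕₚ.<-cmp (lev x) (lev y)
  ... | tri< x<y _ _ = contradiction (λ {z} → D⊆-lev {x} {y} x<y {z}) ¬Dx⊆Dy
  ... | tri> _ _ y<x = contradiction (λ {z} → D⊆-lev {y} {x} y<x {z}) ¬Dy⊆Dx
  ... | tri≈ _ x≡y _ with Finₚ.<-cmp (pos x) (pos y)
  ...   | tri< px<py _ _ = contradiction (λ {z} → D⊆-pos {x} {y} x≡y px<py {z}) ¬Dx⊆Dy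
  ...   | tri> _ _ py<px = contradiction (λ {z} → D⊆-pos {y} {x} (sym x≡y) py<px {z}) ¬Dy⊆Dx
  ...   | tri≈ _ px≡py _ with isUpper? x | isUpper? y
  ...     | yes ux | yes uy = px≡py , ux , uy
  ...     | no ¬ux | _      = contradiction (λ {z} → D⊆-same {x} {y} x≡y px≡py ¬ux {z}) ¬Dx⊆Dy
  ...     | yes _  | no ¬uy = contradiction (λ {z} → D⊆-same {y} {x} (sym x≡y) (sym px≡py) ¬uy {z}) ¬Dy⊆Dx

  ⊥⇒sameLower : ∀ {x y} → x ⊥ y → SameLower x y
  ⊥⇒sameLower {x} {y} (¬Ux⊆Uy , ¬Uy⊆Ux) with ℕₚ.<-cmp (lev x) (lev y)
  ... | tri< x<y _ _ = contradiction (λ {z} → U⊆-lev {x} {y} x<y {z}) ¬Uy⊆Ux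
  ... | tri> _ _ y<x = contradiction (λ {z} → U⊆-lev {y} {x} y<x {z}) ¬Ux⊆Uy
  ... | tri≈ _ x≡y _ with Finₚ.<-cmp (pos x) (pos y)
  ...   | tri< px<py _ _ = contradiction (λ {z} → U⊆-pos {x} {y} x≡y px<py {z}) ¬Uy⊆Ux
  ...   | tri> _ _ py<px = contradiction (λ {z} → U⊆-pos {y} {x} (sym x≡y) py<px {z}) ¬Ux⊆Uy
  ...   | tri≈ _ px≡py _ with isLower? x | isLower? y
  ...     | yes lx | yes ly = px≡py , lx , ly
  ...     | no ¬lx | _      = contradiction (λ {z} → U⊆-same {x} {y} x≡y px≡py ¬lx {z}) ¬Ux⊆Uy
  ...     | yes _  | no ¬ly = contradiction (λ {z} → U⊆-same {y} {x} (sym x≡y) (sym px≡py) ¬ly {z}) ¬Uy⊆Ux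

  upper-shape : ∀ {x} → IsUpper x → (∃[ i ] letter x ≡ t i) × side x ≡ 1F
  upper-shape {x} up with letter x | side x
  ... | c i | _  = contradiction up (ℕₚ.<-irrefl refl)
  ... | t i | 0F = contradiction up (ℕₚ.<-irrefl refl)
  ... | t i | 1F = (i , refl) , refl

  lower-shape : ∀ {x} → IsLower x → (∃[ i ] letter x ≡ t i) × side x ≡ 0F
  lower-shape {x} low with letter x | side x
  ... | c i | _  = contradiction low (ℕₚ.<-irrefl refl)
  ... | t i | 0F = (i , refl) , refl
  ... | t i | 1F = contradiction low (ℕₚ.<-irrefl refl)

  vertex-injective : ∀ {x y} → pos x ≡ pos y → side x ≡ side y → idx x ≡ idx y → x ≡ y
  vertex-injective {x} {y} p s i = trans (sym (vertex-η x)) (trans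
    (trans (cong₂ (λ p s → vertex p s (idx x)) p s) (cong (vertex (pos y) (side y)) i)) (vertex-η y))

  upper-¬D⊆ : ∀ {x y} → SameUpper x y → x ≢ y → ¬ D↓ x ⊆ D↓ y
  upper-¬D⊆ {x} {y} (px≡py , ux , uy) x≢y Dx⊆Dy = go (<-next⇒link {z} {y} (trans 1+z≡x x≡y) (Dx⊆Dy {z} z<x))
    where
    -- The lower end of the edge of `x`: among the upper vertices of the letter, only `x` is above
    -- it.
    z = vertex (pos x) 0F (idx x)
    pz≡px : pos z ≡ pos x
    pz≡px = pos-vertex (pos x) 0F (idx x)
    x≡y : lev x ≡ lev y
    x≡y = trans (upper-lev {x} ux) (trans (cong (end ∘ lookup w) px≡py) (sym (upper-lev {y} uy)))
    1+z≡x : suc (lev z) ≡ lev x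
    1+z≡x = trans (cong suc (lev-vertex (pos x) 0F (idx x))) shape
      where
      shape : suc (height (letter x) 0F) ≡ lev x
      shape with letter x | upper-shape {x} ux
      ... | _ | (i , refl) , s≡1 = cong (λ s → toℕ s + i) (sym s≡1)
    z<x : z < x
    z<x = inj₂ (1+z≡x , inj₂ (pz≡px , idx-vertex (pos x) 0F (idx x)))
    go : ¬ Link z y
    go (inj₁ pz<py)       = Finₚ.<-irrefl (trans pz≡px px≡py) pz<py
    go (inj₂ (_ , iz≡iy)) = x≢y (vertex-injective px≡py
      (trans (proj₂ (upper-shape {x} ux)) (sym (proj₂ (upper-shape {y} uy))))
      (trans (sym (idx-vertex (pos x) 0F (idx x))) iz≡iy))

  lower-¬U⊆ : ∀ {x y} → SameLower x y → x ≢ y → ¬ U↑ x ⊆ U↑ y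
  lower-¬U⊆ {x} {y} (px≡py , lx , ly) x≢y Ux⊆Uy =
    go (<-next⇒link {y} {z} (trans (cong suc (sym x≡y)) 1+x≡z) (Ux⊆Uy {z} x<z))
    where
    z = vertex (pos x) 1F (idx x)
    pz≡px : pos z ≡ pos x
    pz≡px = pos-vertex (pos x) 1F (idx x)
    x≡y : lev x ≡ lev y
    x≡y = trans (lower-lev {x} lx) (trans (cong (start ∘ lookup w) px≡py) (sym (lower-lev {y} ly)))
    1+x≡z : suc (lev x) ≡ lev z
    1+x≡z = trans shape (sym (lev-vertex (pos x) 1F (idx x)))
      where
      shape : suc (lev x) ≡ height (letter x) 1F
      shape with letter x | lower-shape {x} lx
      ... | _ | (i , refl) , s≡0 = cong (λ s → suc (toℕ s + i)) s≡0
    x<z : x < z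
    x<z = inj₂ (1+x≡z , inj₂ (sym pz≡px , sym (idx-vertex (pos x) 1F (idx x))))
    go : ¬ Link y z
    go (inj₁ py<pz)       = Finₚ.<-irrefl (sym (trans pz≡px px≡py)) py<pz
    go (inj₂ (_ , iy≡iz)) = x≢y (vertex-injective px≡py
      (trans (proj₂ (lower-shape {x} lx)) (sym (proj₂ (lower-shape {y} ly))))
      (sym (trans iy≡iz (idx-vertex (pos x) 1F (idx x)))))

  sameUpper⇒⊤ : ∀ {x y} → SameUpper x y → x ≢ y → x ⊤ y
  sameUpper⇒⊤ {x} {y} s@(p , ux , uy) x≢y =
    (λ D⊆ → upper-¬D⊆ {x} {y} s x≢y (λ {z} → D⊆ {z})) ,
    (λ D⊆ → upper-¬D⊆ {y} {x} (sym p , uy , ux) (x≢y ∘ sym) (λ {z} → D⊆ {z}))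

  sameLower⇒⊥ : ∀ {x y} → SameLower x y → x ≢ y → x ⊥ y
  sameLower⇒⊥ {x} {y} s@(p , lx , ly) x≢y =
    (λ U⊆ → lower-¬U⊆ {x} {y} s x≢y (λ {z} → U⊆ {z})) ,
    (λ U⊆ → lower-¬U⊆ {y} {x} (sym p , ly , lx) (x≢y ∘ sym) (λ {z} → U⊆ {z}))

  -- Serves tops and bottoms alike: `R` is a complete graph on the `P`-vertices of each letter and
  -- has no other edges.
  module Components (R : Rel (Fin n) 0ℓ) {P : Pred (Fin n) 0ℓ} (P? : ∀ x → Dec (P x))
    (sound : ∀ {x y} → R x y → pos x ≡ pos y × P x × P y)
    (complete : ∀ {x y} → pos x ≡ pos y × P x × P y → x ≢ y → R x y) where

    class? : ∀ p x → Dec (pos x ≡ p × P x)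
    class? p x = (pos x Finₚ.≟ p) ×-dec P? x

    class : Fin m → Subset n
    class p = subsetOf (class? p)

    ∈-class : ∀ p x → x ∈ class p ⇔ (pos x ≡ p × P x)
    ∈-class p = ∈-subsetOf (class? p)

    star-sound : ∀ {x y} → Star R x y → x ≡ y ⊎ (pos x ≡ pos y × P x × P y)
    star-sound ε = inj₁ refl
    star-sound (xRy ◅ y⋆z) with sound xRy | star-sound y⋆z
    ... | same            | inj₁ refl           = inj₂ same
    ... | px≡py , Px , _ | inj₂ (py≡pz , _ , Pz) = inj₂ (trans px≡py py≡pz , Px , Pz)

    class⇔star : ∀ a → P a → ∀ x → x ∈ class (pos a) ⇔ Star R a x
    class⇔star a Pa x = mk⇔ connect
      (from (∈-class (pos a) x) ∘ [ (λ { refl → refl , Pa }) , (λ (pa≡px , _ , Px) → sym pa≡px , Px) ]′ ∘ star-sound)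
      where
      connect : x ∈ class (pos a) → Star R a x
      connect x∈ with a Finₚ.≟ x | to (∈-class (pos a) x) x∈
      ... | yes refl | _          = ε
      ... | no a≢x   | px≡pa , Px = complete (sym px≡pa , Pa , Px) a≢x ◅ ε

    component⇒class : ∀ {A x y} → IsComponent R A → x ∈ A → y ∈ A → x ≢ y → ∃[ a ] P a × A ≡ class (pos a)
    component⇒class {A} {x} {y} (a , ∈A) x∈ y∈ x≢y = a , Pa , ⊆-antisym
      (λ {z} z∈ → from (class⇔star a Pa z) (to (∈A z) z∈))
      (λ {z} z∈ → from (∈A z) (to (class⇔star a Pa z) z∈))
      where
      Pa : P a
      -- Two distinct members exclude the component of an isolated vertex.
      Pa with star-sound (to (∈A x) x∈) | star-sound (to (∈A y) y∈)
      ... | inj₂ (_ , Pa , _) | _                 = Pa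
      ... | inj₁ _            | inj₂ (_ , Pa , _) = Pa
      ... | inj₁ refl         | inj₁ refl         = contradiction refl x≢y

  module Tops = Components _⊤_ isUpper? (λ {x} {y} → ⊤⇒sameUpper {x} {y}) (λ {x} {y} → sameUpper⇒⊤ {x} {y})
  module Bottoms = Components _⊥_ isLower? (λ {x} {y} → ⊥⇒sameLower {x} {y}) (λ {x} {y} → sameLower⇒⊥ {x} {y})

  -- Parts of the realisation

  clones? : ∀ p x → Dec (pos x ≡ p)
  clones? p x = pos x Finₚ.≟ p

  clones : Fin m → Subset n
  clones p = subsetOf (clones? p)

  partFor : Letter → Fin m → Part n
  partFor (c _) p = cloneSet (clones p)
  partFor (t _) p = tangle (Tops.class p) (Bottoms.class p)

  partAt : Fin m → Part n
  partAt p = partFor (lookup w p) p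

  module _ {p i} (p≡t : lookup w p ≡ t i) where

    t-upper : ∀ j → IsUpper (vertex p 1F j)
    t-upper j = subst₂ ℕ._<_ (sym (trans (cong (start ∘ lookup w) (pos-vertex p 1F j)) (cong start p≡t)))
      (sym (trans (lev-vertex p 1F j) (cong (λ l → height l 1F) p≡t))) ℕₚ.≤-refl

    t-lower : ∀ j → IsLower (vertex p 0F j)
    t-lower j = subst₂ ℕ._<_ (sym (trans (lev-vertex p 0F j) (cong (λ l → height l 0F) p≡t)))
      (sym (trans (cong (end ∘ lookup w) (pos-vertex p 0F j)) (cong end p≡t))) ℕₚ.≤-refl

    t-upper∨lower : ∀ {x} → pos x ≡ p → IsUpper x ⊎ IsLower x
    t-upper∨lower {x} refl with lookup w (pos x) | side x
    t-upper∨lower {x} refl | t i | 0F = inj₂ ℕₚ.≤-refl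
    t-upper∨lower {x} refl | t i | 1F = inj₁ ℕₚ.≤-refl

    vertices-incomparable : ∀ s j s′ j′ → j ≢ j′ → Incomparable (vertex p s j) (vertex p s′ j′)
    vertices-incomparable s j s′ j′ j≢j′ =
      (λ eq → j≢j′ (trans (sym (idx-vertex p s j)) (trans (cong idx eq) (idx-vertex p s′ j′)))) ,
      ¬below s j s′ j′ j≢j′ , ¬below s′ j′ s j (j≢j′ ∘ sym)
      where
      ¬below : ∀ s j s′ j′ → j ≢ j′ → ¬ vertex p s j < vertex p s′ j′
      ¬below s j s′ j′ j≢j′ (inj₁ far) = ℕₚ.<⇒≱ far
        (same-pos⇒lev≤ {vertex p s′ j′} {vertex p s j} (trans (pos-vertex p s′ j′) (sym (pos-vertex p s j))))
      ¬below s j s′ j′ j≢j′ (inj₂ (_ , inj₁ pos<)) =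
        Finₚ.<-irrefl (trans (pos-vertex p s j) (sym (pos-vertex p s′ j′))) pos<
      ¬below s j s′ j′ j≢j′ (inj₂ (_ , inj₂ (_ , j≡j′))) =
        j≢j′ (trans (sym (idx-vertex p s j)) (trans j≡j′ (idx-vertex p s′ j′)))

    edge : ∀ j → vertex p 0F j < vertex p 1F j
    edge j = inj₂ (trans (cong suc (trans (lev-vertex p 0F j) (cong (λ l → height l 0F) p≡t)))
                         (sym (trans (lev-vertex p 1F j) (cong (λ l → height l 1F) p≡t))) ,
      inj₂ (trans (pos-vertex p 0F j) (sym (pos-vertex p 1F j)) , trans (idx-vertex p 0F j) (sym (idx-vertex p 1F j))))

    isTangle : IsTangle (Tops.class p) (Bottoms.class p)
    isTangle =
      (two-elements (a∈ 0F) (a∈ 1F) a₀≢a₁ ,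
        vertex p 1F 0F ,
        subst (λ q → ∀ x → x ∈ Tops.class q ⇔ Star _⊤_ (vertex p 1F 0F) x) (pos-vertex p 1F 0F) (Tops.class⇔star _ (t-upper 0F))) ,
      (two-elements (b∈ 0F) (b∈ 1F) b₀≢b₁ ,
        vertex p 0F 0F ,
        subst (λ q → ∀ x → x ∈ Bottoms.class q ⇔ Star _⊥_ (vertex p 0F 0F) x) (pos-vertex p 0F 0F) (Bottoms.class⇔star _ (t-lower 0F))) ,
      vertex p 1F 0F , vertex p 1F 1F , vertex p 0F 0F , vertex p 0F 1F ,
      a∈ 0F , a∈ 1F , a₀≢a₁ , b∈ 0F , b∈ 1F , b₀≢b₁ , edge 0F , edge 1F ,
      vertices-incomparable 1F 0F 1F 1F (λ ()) , vertices-incomparable 0F 0F 0F 1F (λ ()) ,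
      vertices-incomparable 0F 0F 1F 1F (λ ()) , vertices-incomparable 0F 1F 1F 0F (λ ())
      where
      a∈ : ∀ j → vertex p 1F j ∈ Tops.class p
      a∈ j = from (Tops.∈-class p _) (pos-vertex p 1F j , t-upper j)
      b∈ : ∀ j → vertex p 0F j ∈ Bottoms.class p
      b∈ j = from (Bottoms.∈-class p _) (pos-vertex p 0F j , t-lower j)
      a₀≢a₁ = proj₁ (vertices-incomparable 1F 0F 1F 1F (λ ()))
      b₀≢b₁ = proj₁ (vertices-incomparable 0F 0F 0F 1F (λ ()))

  -- The tops `a₁` and `a₂` share level and letter, so a bottom from another letter would be below
  -- both or neither. As `b₁` is below `a₁` but not `a₂`, it is joined to `a₁` by an edge, inside
  -- one letter.
  tangle-shape : ∀ {A B} → IsTangle A B → ∃[ p ] ∃[ i ] lookup w p ≡ t i × A ≡ Tops.class p × B ≡ Bottoms.class p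
  tangle-shape {A} {B} ((_ , compA) , (_ , compB) , a₁ , a₂ , b₁ , b₂ , a₁∈ , a₂∈ , a₁≢a₂ , b₁∈ , b₂∈ , b₁≢b₂ ,
                b₁<a₁ , _ , _ , _ , (_ , ¬b₁<a₂ , _) , _)
    with Tops.component⇒class compA a₁∈ a₂∈ a₁≢a₂ | Bottoms.component⇒class compB b₁∈ b₂∈ b₁≢b₂
  ... | a , ua , refl | b , lb , refl =
    pos a , proj₁ (proj₁ (upper-shape {a} ua)) , proj₂ (proj₁ (upper-shape {a} ua)) , refl , cong Bottoms.class pb≡pa
    where
    same₁ = to (Tops.∈-class (pos a) a₁) a₁∈
    same₂ = to (Tops.∈-class (pos a) a₂) a₂∈
    pa₁≡pa₂ : pos a₁ ≡ pos a₂
    pa₁≡pa₂ = trans (proj₁ same₁) (sym (proj₁ same₂))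
    a₁≡a₂ : lev a₁ ≡ lev a₂
    a₁≡a₂ = trans (upper-lev {a₁} (proj₂ same₁)) (trans (cong (end ∘ lookup w) pa₁≡pa₂) (sym (upper-lev {a₂} (proj₂ same₂))))
    pb₁≡pa₁ : b₁ < a₁ → pos b₁ ≡ pos a₁
    pb₁≡pa₁ (inj₁ far)                  = contradiction (inj₁ (subst (2 + lev b₁ ≤_) a₁≡a₂ far)) ¬b₁<a₂
    pb₁≡pa₁ (inj₂ (next , inj₁ pos<))   =
      contradiction (inj₂ (trans next a₁≡a₂ , inj₁ (subst (pos b₁ <ᶠ_) pa₁≡pa₂ pos<))) ¬b₁<a₂
    pb₁≡pa₁ (inj₂ (_ , inj₂ (pos≡ , _))) = pos≡
    pb≡pa : pos b ≡ pos a
    pb≡pa = trans (sym (proj₁ (to (Bottoms.∈-class (pos b) b₁) b₁∈))) (trans (pb₁≡pa₁ b₁<a₁) (proj₁ same₁))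

  elements⇔pos : ∀ p x → x ∈ elements (partAt p) ⇔ pos x ≡ p
  elements⇔pos p x with lookup w p in eq
  ... | c _ = ∈-subsetOf (clones? p) x
  ... | t _ = mk⇔
    ([ proj₁ ∘ to (Tops.∈-class p x) , proj₁ ∘ to (Bottoms.∈-class p x) ]′ ∘ x∈p∪q⁻ (Tops.class p) (Bottoms.class p))
    (λ px≡p → x∈p∪q⁺ (
      [ (λ u → inj₁ (from (Tops.∈-class p x) (px≡p , u))) , (λ l → inj₂ (from (Bottoms.∈-class p x) (px≡p , l)))
      ]′ (t-upper∨lower eq {x} px≡p)))

  IsC : Letter → Set
  IsC x = ∃[ i ] x ≡ c i

  noTangle⇔c : ∀ x → InNoTangle x ⇔ IsC (letter x)
  noTangle⇔c x = mk⇔ isC λ (i , x≡c) A B tan x∈ → none x≡c (tangle-shape tan) x∈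
    where
    isC : InNoTangle x → IsC (letter x)
    isC none with letter x in eq | from (elements⇔pos (pos x) x) refl
    ... | c i | _  = i , refl
    ... | t i | x∈ = contradiction x∈ (none (Tops.class (pos x)) (Bottoms.class (pos x)) (isTangle eq))
    none : ∀ {A B i} → letter x ≡ c i →
      ∃[ p ] ∃[ j ] lookup w p ≡ t j × A ≡ Tops.class p × B ≡ Bottoms.class p → x ∉ A ∪ B
    none x≡c (p , j , p≡t , refl , refl) x∈ with
      [ proj₁ ∘ to (Tops.∈-class p x) , proj₁ ∘ to (Bottoms.∈-class p x) ]′ (x∈p∪q⁻ (Tops.class p) (Bottoms.class p) x∈)
    ... | refl with trans (sym x≡c) p≡t
    ...   | ()

  c-lev : ∀ {x i} → letter x ≡ c i → lev x ≡ i
  c-lev {x} x≡c = cong (λ l → height l (side x)) x≡c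

  c-¬upper : ∀ {x i} → letter x ≡ c i → ¬ IsUpper x
  c-¬upper {x} x≡c up = ℕₚ.<-irrefl (trans (cong start x≡c) (sym (c-lev {x} x≡c))) up

  c-¬lower : ∀ {x i} → letter x ≡ c i → ¬ IsLower x
  c-¬lower {x} x≡c low = ℕₚ.<-irrefl (trans (c-lev {x} x≡c) (sym (cong end x≡c))) low

  same-pos⇒≈ : ∀ {x y i} → letter x ≡ c i → pos x ≡ pos y → x ≈ y
  same-pos⇒≈ {x} {y} x≡c px≡py =
    ((λ {z} → D⊆-same {x} {y} x≡y px≡py (c-¬upper {x} x≡c) {z}) ,
     (λ {z} → D⊆-same {y} {x} (sym x≡y) (sym px≡py) (c-¬upper {y} y≡c) {z})) ,
    ((λ {z} → U⊆-same {x} {y} x≡y px≡py (c-¬lower {x} x≡c) {z}) ,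
     (λ {z} → U⊆-same {y} {x} (sym x≡y) (sym px≡py) (c-¬lower {y} y≡c) {z}))
    where
    y≡c = trans (cong (lookup w) (sym px≡py)) x≡c
    x≡y : lev x ≡ lev y
    x≡y = trans (c-lev {x} x≡c) (sym (c-lev {y} y≡c))

  -- If `x` were higher, it would have below it a vertex of level at least `lev y`, which is not
  -- below `y`. Hence `≈` determines the level.
  D⊆⇒lev≤ : ∀ {x y} → D↓ x ⊆ D↓ y → lev x ≤ lev y
  D⊆⇒lev≤ {x} {y} Dx⊆Dy = ℕₚ.≮⇒≥ λ y<x → let z , z<x , y≤z = ground {lev y} {x} y<x in
    ℕₚ.<⇒≱ (<⇒lev< {z} {y} (Dx⊆Dy {z} z<x)) y≤z

  -- A letter between two occurrences of `c i` supplies a separating vertex `z`: on level i+1 it is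
  -- above `x` but not `y`, on level i-1 it is below `y` but not `x`.
  ≈⇒pos≮ : ∀ {x y i} → letter x ≡ c i → letter y ≡ c i → x ≈ y → ¬ pos x <ᶠ pos y
  ≈⇒pos≮ {x} {y} {i} x≡c y≡c ((_ , Dy⊆Dx) , (Ux⊆Uy , _)) px<py with between path (pos x) (pos y) px<py x≡c y≡c
  ... | r , j , px<r , r<py , r∋j , j≡ with vertexAt r r∋j
  ...   | z , refl , z≡j with j≡
  ...     | inj₁ j≡1+i = ℕₚ.<⇒≱ r<py
    (link⇒pos≤ {y} {z} (<-next⇒link {y} {z} (next y y≡c) (Ux⊆Uy {z} (inj₂ (next x x≡c , inj₁ px<r)))))
    where
    next : ∀ x → letter x ≡ c i → suc (lev x) ≡ lev z
    next x x≡c = trans (cong suc (c-lev {x} x≡c)) (trans (sym j≡1+i) (sym z≡j))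
  ...     | inj₂ 1+j≡i = ℕₚ.<⇒≱ px<r
    (link⇒pos≤ {z} {x} (<-next⇒link {z} {x} (next x x≡c) (Dy⊆Dx {z} (inj₂ (next y y≡c , inj₁ r<py)))))
    where
    next : ∀ x → letter x ≡ c i → suc (lev z) ≡ lev x
    next x x≡c = trans (cong suc z≡j) (trans 1+j≡i (sym (c-lev {x} x≡c)))

  clone⇔pos : ∀ a → IsC (letter a) → ∀ x → (InNoTangle x × a ≈ x) ⇔ pos x ≡ pos a
  clone⇔pos a (i , a≡c) x = mk⇔ same-pos λ px≡pa →
    from (noTangle⇔c x) (i , trans (cong (lookup w) px≡pa) a≡c) , same-pos⇒≈ {a} {x} a≡c (sym px≡pa)
    where
    same-pos : InNoTangle x × a ≈ x → pos x ≡ pos a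
    same-pos (none , a≈x@((Da⊆Dx , Dx⊆Da) , (Ua⊆Ux , Ux⊆Ua))) with to (noTangle⇔c x) none
    ... | j , x≡c with trans (sym (c-lev {a} a≡c)) (trans
          (ℕₚ.≤-antisym (D⊆⇒lev≤ {a} {x} (λ {z} → Da⊆Dx {z})) (D⊆⇒lev≤ {x} {a} (λ {z} → Dx⊆Da {z})))
          (c-lev {x} x≡c))
    ...   | refl with Finₚ.<-cmp (pos x) (pos a)
    ...     | tri≈ _ px≡pa _ = px≡pa
    ...     | tri< px<pa _ _ = contradiction px<pa (≈⇒pos≮ {x} {a} x≡c a≡c ((Dx⊆Da , Da⊆Dx) , (Ux⊆Ua , Ua⊆Ux)))
    ...     | tri> _ _ pa<px = contradiction pa<px (≈⇒pos≮ {a} {x} a≡c x≡c a≈x)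

  partAt-isPart : ∀ p → IsPart (partAt p)
  partAt-isPart p with lookup w p in eq
  ... | t i = isTangle eq
  ... | c i = a , from (noTangle⇔c a) (i , a≡c) , λ x → mk⇔
      (λ x∈ → from (clone⇔pos a (i , a≡c) x) (trans (to (∈-subsetOf (clones? p) x) x∈) (sym pa≡p)))
      (λ cl → from (∈-subsetOf (clones? p) x) (trans (to (clone⇔pos a (i , a≡c) x) cl) pa≡p))
    where
    a = vertex p 0F 0F
    pa≡p = pos-vertex p 0F 0F
    a≡c = trans (cong (lookup w) pa≡p) eq

  isPart⇒partAt : ∀ X → IsPart X → ∃[ p ] X ≡ partAt p
  isPart⇒partAt (tangle A B) tan with tangle-shape tan
  ... | p , i , p≡t , refl , refl = p , cong (λ l → partFor l p) (sym p≡t)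
  isPart⇒partAt (cloneSet C) (a , none , ∈C) with to (noTangle⇔c a) none
  ... | i , a≡c = pos a , trans (cong cloneSet C≡) (cong (λ l → partFor l (pos a)) (sym a≡c))
    where
    C≡ : C ≡ clones (pos a)
    C≡ = ⊆-antisym
      (λ {x} x∈ → from (∈-subsetOf (clones? (pos a)) x) (to (clone⇔pos a (i , a≡c) x) (to (∈C x) x∈)))
      (λ {x} x∈ → from (∈C x) (from (clone⇔pos a (i , a≡c) x) (to (∈-subsetOf (clones? (pos a)) x) x∈)))

  partAt-injective : ∀ {p q} → partAt p ≡ partAt q → p ≡ q
  partAt-injective {p} {q} eq = trans (sym (pos-vertex p 0F 0F)) (to (elements⇔pos q x)
    (subst (λ X → x ∈ elements X) eq (from (elements⇔pos p x) (pos-vertex p 0F 0F))))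
    where x = vertex p 0F 0F

  partAt-before : ∀ {p q} → p <ᶠ q → Before (partAt p) (partAt q)
  partAt-before {p} {q} p<q a b a∈ b∈ k l ka lb with
    to (elements⇔pos p a) a∈ | to (elements⇔pos q b) b∈ | to (level⇔ k a) ka | to (level⇔ l b) lb
  ... | refl | refl | refl | refl = mk⇔ (<⇒lev< {a} {b}) below , mk⇔ above (inj₁ ∘ subst (_≤ lev a) (ℕₚ.+-comm (lev b) 2))
    where
    below : lev a ℕ.< lev b → a < b
    below a<b with ℕₚ.m≤n⇒m<n∨m≡n a<b
    ... | inj₁ far  = inj₁ far
    ... | inj₂ next = inj₂ (next , inj₁ p<q)
    above : b < a → lev b + 2 ≤ lev a
    above (inj₁ far)     = subst (_≤ lev a) (ℕₚ.+-comm 2 (lev b)) far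
    above (inj₂ (_ , l)) = contradiction (link⇒pos≤ {b} {a} l) (ℕₚ.<⇒≱ p<q)

  partAt-hasLetter : ∀ p → HasLetter (partAt p) (lookup w p)
  partAt-hasLetter p with lookup w p in eq | elements⇔pos p
  ... | c i | ∈⇔ = clone-c λ x x∈ → from (level⇔ i x) (c-lev {x} (trans (cong (lookup w) (to (∈⇔ x) x∈)) eq))
  ... | t i | ∈⇔ = tangle-t λ x x∈ → levels x (trans (cong (lookup w) (to (∈⇔ x) x∈)) eq)
    where
    levels : ∀ x → letter x ≡ t i → Level i x ⊎ Level (suc i) x
    levels x x≡t with t-upper∨lower x≡t {x} refl
    ... | inj₁ up  = inj₂ (from (level⇔ (suc i) x) (trans (upper-lev {x} up) (cong end x≡t)))
    ... | inj₂ low = inj₁ (from (level⇔ i x) (trans (lower-lev {x} low) (cong start x≡t)))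

  isSkeleton : IsSkeleton w
  isSkeleton = n , _<_ , isDecStrictPartialOrder , ⟨3+1⟩-free , List.tabulate partAt ,
    record
      { unique     = Unique.tabulate⁺ partAt-injective
      ; parts      = λ X → mk⇔
          (λ X∈ → let p , X≡ = ∈-tabulate⁻ X∈ in subst IsPart (sym X≡) (partAt-isPart p))
          (λ part → let p , X≡ = isPart⇒partAt X part in subst (_∈ˡ List.tabulate partAt) (sym X≡) (∈-tabulate⁺ p))
      ; compatible = before⇒compatible (List.tabulate partAt) (AllPairsₚ.tabulate⁺-< partAt-before)
      } ,
    w , subst (Pointwise HasLetter (List.tabulate partAt)) (tabulate-lookup w) (Pointwise.tabulate⁺ partAt-hasLetter) , ε

-- Counting skeleta by their normal words

#c-↝ : ∀ {u v} → u ↝ v → #c u ≡ #c v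
#c-↝ (swap w (c-c _))   = refl
#c-↝ (swap w (c-t _))   = refl
#c-↝ (swap w (t-t _))   = refl
#c-↝ (skip (c _) u↝v) = cong suc (#c-↝ u↝v)
#c-↝ (skip (t _) u↝v) = #c-↝ u↝v

#t-↝ : ∀ {u v} → u ↝ v → #t u ≡ #t v
#t-↝ (swap w (c-c _))   = refl
#t-↝ (swap w (c-t _))   = refl
#t-↝ (swap w (t-t _))   = refl
#t-↝ (skip (c _) u↝v) = #t-↝ u↝v
#t-↝ (skip (t _) u↝v) = cong suc (#t-↝ u↝v)

lookup-injective : ∀ {A : Set} {xs : List A} → Unique xs → ∀ i j → lookup xs i ≡ lookup xs j → i ≡ j
lookup-injective (_ ∷ _)    zero    zero    _  = refl
lookup-injective (x≢ ∷ _)   zero    (suc j) eq = contradiction eq (All.lookup x≢ (∈-lookup j))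
lookup-injective (x≢ ∷ _)   (suc i) zero    eq = contradiction (sym eq) (All.lookup x≢ (∈-lookup i))
lookup-injective (_ ∷ uniq) (suc i) (suc j) eq = cong suc (lookup-injective uniq i j eq)

skeleta-cardinality : ∀ r s → HasCardinality (Skeleta r s) (length (pathsBelow 1 r s))
skeleta-cardinality r s = record
  { to        = word
  ; cong      = λ { refl → ε }
  ; bijective = injective , surjective
  }
  where
  ws = pathsBelow 1 r s
  sound : ∀ i → Path (Below 1) (lookup ws i) × Sized r s (lookup ws i)
  sound i = pathsBelow-sound 1 r s (∈-lookup i)
  word : Fin (length ws) → ∃[ w ] IsSkeleton w × #c w ≡ r × #t w ≡ s
  word i = lookup ws i , Realisation.isSkeleton (lookup ws i) (proj₁ (sound i)) , proj₂ (sound i)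
  injective : ∀ {i j} → lookup ws i ≈ᴹ lookup ws j → i ≡ j
  injective {i} {j} eq = lookup-injective (pathsBelow-unique 1 r s) i j
    (trans (sym (nf-path (proj₁ (sound i)))) (trans (nf-cong eq) (nf-path (proj₁ (sound j)))))
  surjective : ∀ ((w , _) : ∃[ w ] IsSkeleton w × #c w ≡ r × #t w ≡ s) →
               ∃[ i ] (∀ {j} → j ≡ i → lookup ws j ≈ᴹ w)
  surjective (w , skel , refl , refl) = index nf∈ , λ { refl → subst (_≈ᴹ w) (lookup-index nf∈) (nf-≈ w) }
    where
    nf∈ : nf w ∈ˡ ws
    -- Letter counts are invariant under commutation, so the normal form is enumerated under the
    -- same r and s.
    nf∈ = subst₂ (λ r s → nf w ∈ˡ pathsBelow 1 r s)
      (EqC.gfold ≡.isEquivalence #c #c-↝ (nf-≈ w)) (EqC.gfold ≡.isEquivalence #t #t-↝ (nf-≈ w))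
      (pathsBelow-complete (skeleton⇒path skel))

theorem3p15 : Σ (ℕ → ℕ → ℕ) λ N →
    (∀ r s → HasCardinality (Skeleta r s) (N r s)) ×
    SatisfiesEquation (genFun N) ×
    (∀ (F : Series) → SatisfiesEquation F → F ≈ₛ genFun N)
theorem3p15 = N , skeleta-cardinality , fixed⇒satisfies N-fixed ,
  λ F eq → fixed-unique (satisfies⇒fixed eq) N-fixed
  where
  N : ℕ → ℕ → ℕ
  -- The bound 1 makes the first letter start at level 0 and selects the first power of `T`.
  N r s = length (pathsBelow 1 r s)
  N-fixed : ∀ r s → genFun N r s ≡ Φ (genFun N) r s
  N-fixed = ≈T⇒fixed (λ r s → trans (ι∣pathsBelow∣ 1 r s) (T^1 r s))
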